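{- Let $k,\ell,t,q$ be positive integers with $k\geq 4$. There exists a constant $C$ depending on $k,\ell,t,q$ such that for every sufficiently large $n$ (depending on $k,\ell$), every family $\mathcal{F}\subseteq\binom{[n]}{k}$ with $|\mathcal{F}|\geq t\binom{n}{k-1}+Cn^{k-2+\frac{2}{k-1}}$ contains a copy of $\mathbb{P}^{(k)}_\ell$ or a copy of $[K_{t+1,q}]^{(k)}$.
   Context: A $k$-uniform linear path of length $\ell$, $\mathbb{P}^{(k)}_\ell$, is a family of $k$-sets $\{F_1,\ldots,F_\ell\}$ with $|F_i\cap F_{i+1}|=1$ for each $i$ and $F_i\cap F_j=\emptyset$ whenever $|i-j|>1$. For a graph $H$, the $k$-blowup $[H]^{(k)}$ is the $k$-uniform hypergraph obtained by replacing each edge $xy$ of $H$ by a $k$-set consisting of $x$, $y$ and $k-2$ new vertices, where the new vertex sets are pairwise disjoint for distinct edges. $K_{t+1,q}$ is the complete bipartite graph with parts of sizes $t+1$ and $q$. A family contains a copy of a hypergraph if some subfamily is isomorphic to it. -}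

module Defs where

open import Data.Nat using (ℕ; suc; _+_; _*_; _∸_; _^_; _≤_)
open import Data.Nat.Combinatorics using (_C_)
open import Data.Fin using (Fin; toℕ)
open import Data.Fin.Subset using (Subset; _∩_; ∣_∣; _∈_; _∉_)
open import Data.List using (List; length)
open import Data.List.Relation.Unary.All using (All)
open import Data.List.Relation.Unary.Unique.Propositional using (Unique)
import Data.List.Membership.Propositional as LM
open import Data.Product using (Σ; _×_; ∃)
open import Relation.Binary.PropositionalEquality using (_≡_; _≢_)
open import Relation.Nullary using (¬_)
open import Function.Definitions using (Injective)

record KFamily (n k : ℕ) : Set where
  field
    sets     : List (Subset n)
    distinct : Unique sets
    uniform  : All (λ s → ∣ s ∣ ≡ k) sets

open KFamily public

size : ∀ {n k} → KFamily n k → ℕ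
size F = length (sets F)

_∈F_ : ∀ {n k} → Subset n → KFamily n k → Set
s ∈F F = s LM.∈ sets F

ContainsPath : ∀ {n k} → (ℓ : ℕ) → KFamily n k → Set
ContainsPath {n} ℓ F =
  Σ (Fin ℓ → Subset n) λ E →
    (∀ i → E i ∈F F) ×
    (∀ i j → suc (toℕ i) ≡ toℕ j → ∣ E i ∩ E j ∣ ≡ 1) ×
    (∀ i j → suc (suc (toℕ i)) ≤ toℕ j → ∣ E i ∩ E j ∣ ≡ 0)

-- F contains a copy of the k-blowup [K_{t+1,q}]^(k):
-- distinct core vertices a₀,…,a_t, b₀,…,b_{q-1}, and for every pair (i,j) a set
-- E i j ∈ F containing aᵢ and bⱼ, such that every other vertex of E i j is
-- not a core vertex and lies in no other E i' j' (so the k-2 new vertex sets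
-- are pairwise disjoint and disjoint from the core).
ContainsBlowupK : ∀ {n k} → (t q : ℕ) → KFamily n k → Set
ContainsBlowupK {n} t q F =
  Σ (Fin (suc t) → Fin n) λ a →
  Σ (Fin q → Fin n) λ b →
  Σ (Fin (suc t) → Fin q → Subset n) λ E →
    Injective _≡_ _≡_ a ×
    Injective _≡_ _≡_ b ×
    (∀ i j → a i ≢ b j) ×
    (∀ i j → E i j ∈F F) ×
    (∀ i j → a i ∈ E i j) ×
    (∀ i j → b j ∈ E i j) ×
    (∀ i j v → v ∈ E i j → v ≢ a i → v ≢ b j →
       (∀ i' → v ≢ a i') ×
       (∀ j' → v ≢ b j') ×
       (∀ i' j' → v ∈ E i' j' → (i' ≡ i × j' ≡ j)))

-- The density hypothesis |F| ≥ t·C(n,k-1) + C·n^{k-2+2/(k-1)}, stated without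
-- reals: with X = |F| - t·C(n,k-1) ≥ 0 it is X^{k-1} ≥ C^{k-1}·n^{(k-2)(k-1)+2}.
DenseEnough : ∀ {n k} → (t c : ℕ) → KFamily n k → Set
DenseEnough {n} {k} t c F =
  (t * (n C (k ∸ 1)) ≤ size F) ×
  (c ^ (k ∸ 1) * n ^ ((k ∸ 2) * (k ∸ 1) + 2) ≤ (size F ∸ t * (n C (k ∸ 1))) ^ (k ∸ 1))

{-# OPTIONS --safe #-}
module Submission where

-- Discard edges on (k-1)-sets of at most t extensions; this costs at most t·C(n,k-1) edges.
-- Let 𝒟 be the (k-1)-sets that survive as shadow, each with more than t extensions. Discard
-- further, now on (k-1)-sets of at most ℓk extensions: if an edge is left, a path can be built
-- greedily, and otherwise |𝒟| is at least 1/(ℓk) times the excess, so at least const·n^{k-2}.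
--
-- For D = {d_1, …, d_{k-1}} ∈ 𝒟 fix extensions z_0, …, z_t, and consider for each j the moves
-- (j , i), 0 ≤ i ≤ t+1: replace d_j, keep the other d's and z_0, …, z_{i-1}, and replace z_i
-- (if i ≤ t), avoiding any given bounded set W of vertices. A Füredi-type cleaning argument
-- yields a large subfamily on which each move is either always possible or never possible.
-- If for some j no move is possible, then {d_{j'} : j' ≠ j} determines D up to a bounded number
-- of choices and the subfamily has only O(n^{k-2}) members. So every j has a possible move
-- (j , i_j). If some i_j ≤ t, the edges D ∪ {z_{i_j}} contain long linear paths. If all i_j = t+1,
-- then all d's can be renewed while z_0, …, z_t stay fixed, and the blowup is found greedily.

open import Defs
open import Data.Nat hiding (∣_-_∣)
open import Data.Nat.Properties
open import Data.Nat.Combinatorics using (nCk+nC[k+1]≡[n+1]C[k+1]; nCn≡1; nCk≡nC[n∸k]) renaming (_C_ to _choose_)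
open import Data.Nat.ListAction using (sum)
open import Data.Bool using (Bool; true; false; not)
import Data.Bool.Properties as Bool
open import Data.Fin using (Fin; zero; suc; toℕ; fromℕ<; punchIn; punchOut; combine; remQuot)
import Data.Fin.Properties as Fin
open import Data.Fin.Subset using (Subset; _∩_; _∪_; _-_; _─_; ∣_∣; inside; outside; _∈_; _∉_; ⁅_⁆)
open import Data.Fin.Subset.Properties
  using (_∈?_; ∣⁅x⁆∣≡1; ∣⊥∣≡0; Empty-unique; ⊆-antisym; x∈p∩q⁺; x∈p∩q⁻; x∈p∪q⁺; x∈p∪q⁻;
         x∈⁅x⁆; x∈⁅y⁆⇒x≡y; p─⊥≡p; p─q⊆p; x∈p∧x≢y⇒x∈p-y)
open import Data.Vec using ([]; _∷_; here; there)
import Data.Vec.Properties as Vec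
open import Data.List using (List; []; _∷_; length; filter; map; _++_; allFin; upTo; cartesianProduct)
open import Data.List.Properties using (length-++; length-++-sucʳ; length-map; length-tabulate)
open import Data.List.Membership.Propositional using (find; lose) renaming (_∈_ to _∈ˡ_; _∉_ to _∉ˡ_)
open import Data.List.Membership.Propositional.Properties
open import Data.List.Relation.Binary.Subset.Propositional using () renaming (_⊆_ to _⊆ˡ_)
open import Data.List.Relation.Unary.Any using (Any; here; there; any?)
open import Data.List.Relation.Unary.All as All using ([]; _∷_)
open import Data.List.Relation.Unary.AllPairs using ([]; _∷_)
open import Data.List.Relation.Unary.Unique.Propositional using (Unique)
import Data.List.Relation.Unary.Unique.Propositional.Properties as Unique
open import Data.Product using (∃; _×_; _,_; proj₁; proj₂)
open import Data.Product.Properties using (≡-dec)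
open import Data.Sum using (_⊎_; inj₁; inj₂; [_,_]′)
open import Data.Empty using (⊥-elim)
open import Function using (_∘_; id)
open import Relation.Binary.PropositionalEquality
open import Relation.Nullary using (Dec; yes; no; ¬_; contradiction)
open import Relation.Nullary.Decidable using (map′; _×-dec_; _⊎-dec_; _→-dec_; ¬?; decidable-stable)
open import Relation.Unary using (Pred; Decidable)
open import Relation.Unary.Properties using (∁?)
open import Level using (0ℓ)

-- Counting in finite lists.

private variable
  A K : Set

length-filter-∁ : {P : Pred A 0ℓ} (P? : Decidable P) (xs : List A) →
  length xs ≡ length (filter P? xs) + length (filter (∁? P?) xs)
length-filter-∁ P? []       = refl
length-filter-∁ P? (x ∷ xs) with P? x
... | yes _ = cong suc (length-filter-∁ P? xs)
... | no  _ = trans (cong suc (length-filter-∁ P? xs)) (sym (+-suc _ _))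

extract : {x : A} {xs : List A} → x ∈ˡ xs →
  ∃ λ ys → length xs ≡ suc (length ys) × ys ⊆ˡ xs × (∀ {y} → y ∈ˡ xs → y ≡ x ⊎ y ∈ˡ ys)
extract {x = x} x∈xs with as , bs , refl ← ∈-∃++ x∈xs =
  as ++ bs , length-++-sucʳ as x bs , sub , sup
  where
  sub : as ++ bs ⊆ˡ as ++ x ∷ bs
  sub y∈ with ∈-++⁻ as y∈
  ... | inj₁ y∈as = ∈-++⁺ˡ y∈as
  ... | inj₂ y∈bs = ∈-++⁺ʳ as (there y∈bs)
  sup : ∀ {y} → y ∈ˡ as ++ x ∷ bs → y ≡ x ⊎ y ∈ˡ as ++ bs
  sup y∈ with ∈-++⁻ as y∈
  ... | inj₁ y∈as         = inj₂ (∈-++⁺ˡ y∈as)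
  ... | inj₂ (here y≡x)   = inj₁ y≡x
  ... | inj₂ (there y∈bs) = inj₂ (∈-++⁺ʳ as y∈bs)

unique-⊆-length : {xs ys : List A} → Unique xs → xs ⊆ˡ ys → length xs ≤ length ys
unique-⊆-length {xs = []}     _             _     = z≤n
unique-⊆-length {xs = x ∷ xs} {ys} (x∉xs ∷ u) xs⊆ys
  with zs , eq , _ , sup ← extract (xs⊆ys (here refl)) =
  subst (suc (length xs) ≤_) (sym eq) (s≤s (unique-⊆-length u xs⊆zs))
  where
  xs⊆zs : xs ⊆ˡ zs
  xs⊆zs y∈xs with sup (xs⊆ys (there y∈xs))
  ... | inj₁ refl = contradiction refl (All.lookup x∉xs y∈xs)
  ... | inj₂ y∈zs = y∈zs

-- A union bound: for one `c` after another, the members with `Q c` are split off. The bound `b` is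
-- asked of all duplicate-free sublists because the recursion continues on what is left of `xs`.
cover-length : {Q : K → Pred A 0ℓ} (Q? : ∀ c → Decidable (Q c)) {b : ℕ} (cs : List K) (xs : List A) →
  Unique xs →
  (∀ {x} → x ∈ˡ xs → Any (λ c → Q c x) cs) →
  (∀ {c ys} → c ∈ˡ cs → Unique ys → ys ⊆ˡ xs → (∀ {y} → y ∈ˡ ys → Q c y) → length ys ≤ b) →
  length xs ≤ length cs * b
cover-length Q? []       []       _ _   _ = z≤n
cover-length Q? []       (x ∷ xs) _ cov _ with () ← cov (here refl)
cover-length {A = A} {Q = Q} Q? {b} (c ∷ cs) xs u cov bound =
  subst (_≤ b + length cs * b) (sym (length-filter-∁ (Q? c) xs)) (+-mono-≤
    (bound (here refl) (Unique.filter⁺ (Q? c) u) (λ y∈ → proj₁ (∈-filter⁻ (Q? c) y∈))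
      (λ y∈ → proj₂ (∈-filter⁻ (Q? c) {xs = xs} y∈)))
    (cover-length Q? cs rest (Unique.filter⁺ (∁? (Q? c)) u) cov′
      (λ c∈ u′ ys⊆ → bound (there c∈) u′ (rest⊆ ∘ ys⊆))))
  where
  rest : List A
  rest = filter (∁? (Q? c)) xs
  rest⊆ : rest ⊆ˡ xs
  rest⊆ y∈ = proj₁ (∈-filter⁻ (∁? (Q? c)) y∈)
  cov′ : ∀ {x} → x ∈ˡ rest → Any (λ c → Q c x) cs
  cov′ x∈ with ∈-filter⁻ (∁? (Q? c)) {xs = xs} x∈
  ... | x∈xs , ¬q with cov x∈xs
  ...   | here q  = contradiction q ¬q
  ...   | there p = p

length≤1 : {xs : List A} → Unique xs → (∀ {x y} → x ∈ˡ xs → y ∈ˡ xs → x ≡ y) → length xs ≤ 1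
length≤1 {xs = []}         _                 _    = z≤n
length≤1 {xs = _ ∷ []}     _                 _    = s≤s z≤n
length≤1 {xs = _ ∷ _ ∷ _} ((x≢y ∷ _) ∷ _) same = contradiction (same (here refl) (there (here refl))) x≢y

sum-map-≤ : (f : A → ℕ) {b : ℕ} (xs : List A) → (∀ {x} → x ∈ˡ xs → f x ≤ b) → sum (map f xs) ≤ length xs * b
sum-map-≤ f []       _     = z≤n
sum-map-≤ f (x ∷ xs) bound = +-mono-≤ (bound (here refl)) (sum-map-≤ f xs (bound ∘ there))

sum-map-mono : {f g : A → ℕ} (xs : List A) → (∀ x → f x ≤ g x) → sum (map f xs) ≤ sum (map g xs)
sum-map-mono []       _   = z≤n
sum-map-mono (x ∷ xs) f≤g = +-mono-≤ (f≤g x) (sum-map-mono xs f≤g)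

-- The amount `a` is charged to the single entry `x`. This accounts for a class of members that a
-- cleaning step adds to the waste of one move.
sum-map-+ : {f g : A → ℕ} {a : ℕ} {x : A} {xs : List A} →
  (∀ y → f y ≤ g y) → a + f x ≤ g x → x ∈ˡ xs → a + sum (map f xs) ≤ sum (map g xs)
sum-map-+ {f = f} {g} {a} {x} {_ ∷ xs} f≤g a+fx≤gx (here refl) =
  subst (_≤ sum (map g (x ∷ xs))) (+-assoc a (f x) (sum (map f xs)))
    (+-mono-≤ a+fx≤gx (sum-map-mono xs f≤g))
sum-map-+ {f = f} {g} {a} {xs = y ∷ xs} f≤g a+fx≤gx (there x∈xs) = begin
  a + (f y + sum (map f xs)) ≡⟨ +-assoc a (f y) _ ⟨
  a + f y + sum (map f xs)   ≡⟨ cong (_+ sum (map f xs)) (+-comm a (f y)) ⟩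
  f y + a + sum (map f xs)   ≡⟨ +-assoc (f y) a _ ⟩
  f y + (a + sum (map f xs)) ≤⟨ +-mono-≤ (f≤g y) (sum-map-+ f≤g a+fx≤gx x∈xs) ⟩
  g y + sum (map g xs)       ∎
  where open ≤-Reasoning

find-or-all : {P : Set} {Q : Pred A 0ℓ} (xs : List A) →
  (∀ {x} → x ∈ˡ xs → P ⊎ Q x) → P ⊎ (∀ {x} → x ∈ˡ xs → Q x)
find-or-all []       _ = inj₂ λ ()
find-or-all (x ∷ xs) h with h (here refl) | find-or-all xs (h ∘ there)
... | inj₁ p | _       = inj₁ p
... | inj₂ _ | inj₁ p  = inj₁ p
... | inj₂ q | inj₂ qs = inj₂ λ { (here refl) → q ; (there x∈) → qs x∈ }

-- Cleaning a family until each move is mobile throughout or immobile throughout.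

anyShort? : ∀ {n} w {P : Pred (List (Fin n)) 0ℓ} → Decidable P → Dec (∃ λ W → length W ≤ w × P W)
anyShort? zero P? = map′ (λ p → [] , z≤n , p) (λ { ([] , _ , p) → p }) (P? [])
anyShort? (suc w) P? =
  map′ (λ { (inj₁ p) → [] , z≤n , p ; (inj₂ (x , W , W≤w , p)) → x ∷ W , s≤s W≤w , p })
       (λ { ([] , _ , p) → inj₁ p ; (x ∷ W , s≤s W≤w , p) → inj₂ (x , W , W≤w , p) })
       (P? [] ⊎-dec Fin.any? λ x → anyShort? w (P? ∘ (x ∷_)))

-- The recurrence of `homogenize`: a family without a large homogeneous part has at most `b` members
-- in its core and, for each of its `suc s` moves, at most `coef s * b` in the waste of that move.
coef : ℕ → ℕ
coef zero    = 1
coef (suc s) = 1 + suc s * coef s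

-- A move κ lets f be replaced by any g with Keep κ f g; it is mobile at f if
-- such a g exists outside every list W of at most w forbidden vertices.
-- Immobility is inherited by subfamilies, mobility is not.
module Moves {A K : Set} {n : ℕ} (w : ℕ)
  (_≟K_ : (κ κ′ : K) → Dec (κ ≡ κ′))
  (Keep : K → A → A → Set) (Keep? : ∀ κ f → Decidable (Keep κ f))
  (keep-refl : ∀ {κ f} → Keep κ f f)
  (keep-sym : ∀ {κ f g} → Keep κ f g → Keep κ g f)
  (keep-trans : ∀ {κ f g h} → Keep κ f g → Keep κ g h → Keep κ f h)
  (Hit : K → List (Fin n) → Pred A 0ℓ) (Hit? : ∀ κ W → Decidable (Hit κ W))
  where

  Mobile Immobile : K → List A → A → Set
  Mobile   κ R f = ∀ W → length W ≤ w → ∃ λ g → g ∈ˡ R × Keep κ f g × ¬ Hit κ W g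
  Immobile κ R f = ∃ λ W → length W ≤ w × (∀ {g} → g ∈ˡ R → Keep κ f g → Hit κ W g)

  immobile-⊆ : ∀ {κ R R′ f} → R′ ⊆ˡ R → Immobile κ R f → Immobile κ R′ f
  immobile-⊆ R′⊆R (W , W≤w , hit) = W , W≤w , hit ∘ R′⊆R

  private
    Escape? : ∀ κ W f → Decidable (λ g → Keep κ f g × ¬ Hit κ W g)
    Escape? κ W f g = Keep? κ f g ×-dec ¬? (Hit? κ W g)

    -- Decidable since only finitely many lists over `Fin n` have length at most `w`.
    stuck? : ∀ κ R f → Dec (∃ λ W → length W ≤ w × ¬ Any (λ g → Keep κ f g × ¬ Hit κ W g) R)
    stuck? κ R f = anyShort? w (λ W → ¬? (any? (Escape? κ W f) R))

    stuck⇒immobile : ∀ {κ R f} → (∃ λ W → length W ≤ w × ¬ Any (λ g → Keep κ f g × ¬ Hit κ W g) R) →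
      Immobile κ R f
    stuck⇒immobile (W , W≤w , ¬esc) =
      W , W≤w , λ g∈R keep → decidable-stable (Hit? _ W _) (λ ¬hit → ¬esc (lose g∈R (keep , ¬hit)))

    ¬stuck⇒mobile : ∀ {κ R f} → ¬ (∃ λ W → length W ≤ w × ¬ Any (λ g → Keep κ f g × ¬ Hit κ W g) R) →
      Mobile κ R f
    ¬stuck⇒mobile {κ} {R} {f} ¬stuck W W≤w
      with g , g∈R , esc ← find (decidable-stable (any? (Escape? κ W f) R) λ ¬esc → ¬stuck (W , W≤w , ¬esc)) =
      g , g∈R , esc

  -- Immobility is relative to `waste κ` itself, not to all of `R`. This is what a later restriction
  -- to a part of `waste κ` inherits.
  record Cleaned (L : List K) (R : List A) : Set where
    field
      core         : List A
      core⊆        : core ⊆ˡ R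
      core-unique  : Unique core
      core-mobile  : ∀ {κ f} → κ ∈ˡ L → f ∈ˡ core → Mobile κ core f
      waste        : K → List A
      waste⊆       : ∀ κ → waste κ ⊆ˡ R
      waste-unique : ∀ κ → Unique (waste κ)
      waste-immobile : ∀ κ {f} → f ∈ˡ waste κ → Immobile κ (waste κ) f
      length-≤     : length R ≤ length core + sum (map (length ∘ waste) L)

  -- If `f` is stuck under `κ`, its whole class under the equivalence `Keep κ` goes to `waste κ`,
  -- and the list blocking `f` blocks the class. Classes put into the same waste at different stages
  -- are not related by `Keep κ`, so they do not make each other mobile. `N` bounds the number of
  -- stages, as a class contains at least `f`.
  clean : ∀ L N R → length R ≤ N → Unique R → Cleaned L R
  clean L N R R≤N u with any? (λ f → any? (λ κ → stuck? κ R f) L) R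
  ... | no ¬any = record
    { core = R ; core⊆ = λ x → x ; core-unique = u
    ; core-mobile = λ κ∈L f∈R → ¬stuck⇒mobile (λ s → ¬any (lose f∈R (lose κ∈L s)))
    ; waste = λ _ → [] ; waste⊆ = λ _ () ; waste-unique = λ _ → [] ; waste-immobile = λ _ ()
    ; length-≤ = m≤m+n _ _ }
  clean L N R R≤N u | yes any with f , f∈R , anyκ ← find any with κ , κ∈L , stuck ← find anyκ = go N R≤N
    where
    class rest : List A
    class = filter (Keep? κ f) R
    rest  = filter (∁? (Keep? κ f)) R
    class⊆ : class ⊆ˡ R
    class⊆ g∈ = proj₁ (∈-filter⁻ (Keep? κ f) g∈)
    rest⊆ : rest ⊆ˡ R
    rest⊆ g∈ = proj₁ (∈-filter⁻ (∁? (Keep? κ f)) g∈)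
    class-keep : ∀ {g} → g ∈ˡ class → Keep κ f g
    class-keep g∈ = proj₂ (∈-filter⁻ (Keep? κ f) {xs = R} g∈)
    rest-¬keep : ∀ {g} → g ∈ˡ rest → ¬ Keep κ f g
    rest-¬keep g∈ = proj₂ (∈-filter⁻ (∁? (Keep? κ f)) {xs = R} g∈)
    split : length R ≡ length class + length rest
    split = length-filter-∁ (Keep? κ f) R
    0<class : 0 < length class
    0<class = ∈-length (∈-filter⁺ (Keep? κ f) f∈R keep-refl)

    go : ∀ N → length R ≤ N → Cleaned L R
    go zero    R≤0 = contradiction (≤-trans (∈-length f∈R) R≤0) λ ()
    go (suc N) R≤N = record
      { core = core ; core⊆ = rest⊆ ∘ core⊆ ; core-unique = core-unique ; core-mobile = core-mobile
      ; waste = waste′ ; waste⊆ = waste′⊆ ; waste-unique = waste′-unique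
      ; waste-immobile = waste′-immobile ; length-≤ = length-≤′ }
      where
      rest≤N : length rest ≤ N
      rest≤N = s≤s⁻¹ (≤-trans (+-monoˡ-≤ (length rest) 0<class) (subst (_≤ suc N) split R≤N))
      open Cleaned (clean L N rest rest≤N (Unique.filter⁺ (∁? (Keep? κ f)) u))

      waste′ : K → List A
      waste′ κ′ with κ′ ≟K κ
      ... | yes _ = class ++ waste κ
      ... | no  _ = waste κ′

      big⊆ : class ++ waste κ ⊆ˡ R
      big⊆ g∈ with ∈-++⁻ class g∈
      ... | inj₁ g∈class = class⊆ g∈class
      ... | inj₂ g∈waste = rest⊆ (waste⊆ κ g∈waste)

      waste′⊆ : ∀ κ′ → waste′ κ′ ⊆ˡ R
      waste′⊆ κ′ with κ′ ≟K κ
      ... | yes _ = big⊆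
      ... | no  _ = rest⊆ ∘ waste⊆ κ′

      waste′-unique : ∀ κ′ → Unique (waste′ κ′)
      waste′-unique κ′ with κ′ ≟K κ
      ... | yes _ = Unique.++⁺ (Unique.filter⁺ (Keep? κ f) u) (waste-unique κ)
                      (λ { (∈c , ∈w) → rest-¬keep (waste⊆ κ ∈w) (class-keep ∈c) })
      ... | no  _ = waste-unique κ′

      big-immobile : ∀ {g} → g ∈ˡ class ++ waste κ → Immobile κ (class ++ waste κ) g
      big-immobile g∈ with ∈-++⁻ class g∈
      ... | inj₁ g∈class with W , W≤w , hit ← stuck⇒immobile stuck =
        W , W≤w , λ h∈ keep → hit (big⊆ h∈) (keep-trans (class-keep g∈class) keep)
      ... | inj₂ g∈waste with W , W≤w , hit ← waste-immobile κ g∈waste = W , W≤w , hit′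
        where
        hit′ : ∀ {h} → h ∈ˡ class ++ waste κ → Keep κ _ h → Hit κ W h
        hit′ h∈ keep with ∈-++⁻ class h∈
        ... | inj₁ h∈class = contradiction (keep-trans (class-keep h∈class) (keep-sym keep))
                               (rest-¬keep (waste⊆ κ g∈waste))
        ... | inj₂ h∈waste = hit h∈waste keep

      waste′-immobile : ∀ κ′ {g} → g ∈ˡ waste′ κ′ → Immobile κ′ (waste′ κ′) g
      waste′-immobile κ′ with κ′ ≟K κ
      ... | yes refl = big-immobile
      ... | no  _    = waste-immobile κ′

      waste≤ : ∀ κ′ → length (waste κ′) ≤ length (waste′ κ′)
      waste≤ κ′ with κ′ ≟K κ
      ... | yes refl = subst (length (waste κ) ≤_) (sym (length-++ class)) (m≤n+m _ (length class))
      ... | no  _    = ≤-refl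

      class+waste≤ : length class + length (waste κ) ≤ length (waste′ κ)
      class+waste≤ with κ ≟K κ
      ... | yes _   = ≤-reflexive (sym (length-++ class))
      ... | no  κ≢κ = contradiction refl κ≢κ

      length-≤′ : length R ≤ length core + sum (map (length ∘ waste′) L)
      length-≤′ = begin
        length R                                           ≡⟨ split ⟩
        length class + length rest                         ≤⟨ +-monoʳ-≤ (length class) length-≤ ⟩
        length class + (length core + Σwaste)              ≡⟨ +-assoc (length class) _ _ ⟨
        length class + length core + Σwaste                ≡⟨ cong (_+ Σwaste) (+-comm (length class) _) ⟩
        length core + length class + Σwaste                ≡⟨ +-assoc (length core) _ _ ⟩
        length core + (length class + Σwaste)              ≤⟨ +-monoʳ-≤ (length core) (sum-map-+ waste≤ class+waste≤ κ∈L) ⟩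
        length core + sum (map (length ∘ waste′) L)        ∎
        where
        open ≤-Reasoning
        Σwaste : ℕ
        Σwaste = sum (map (length ∘ waste) L)

  Homogeneous : List K → List A → Set
  Homogeneous L R = ∀ {κ} → κ ∈ˡ L → (∀ {f} → f ∈ˡ R → Mobile κ R f) ⊎ (∀ {f} → f ∈ˡ R → Immobile κ R f)

  -- Induction on the number of moves. A large core settles all moves as mobile. Inside `waste κ`
  -- the move `κ` is already settled as immobile, also for every subfamily, so the induction
  -- hypothesis is applied there to the remaining moves. If core and wastes are all small, so is
  -- `R`.
  homogenize : ∀ s L → length L ≡ s → ∀ b R → Unique R →
    (∃ λ R′ → b < length R′ × Unique R′ × R′ ⊆ˡ R × Homogeneous L R′) ⊎ length R ≤ coef s * b
  homogenize zero [] refl b R u with b <? length R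
  ... | yes b<R = inj₁ (R , b<R , u , (λ x → x) , λ ())
  ... | no  b≮R = inj₂ (≤-trans (≮⇒≥ b≮R) (≤-reflexive (sym (+-identityʳ b))))
  homogenize (suc s) L eq b R u = go (b <? length core)
    where
    open Cleaned (clean L (length R) R ≤-refl u)
    Found : Set
    Found = ∃ λ R′ → b < length R′ × Unique R′ × R′ ⊆ˡ R × Homogeneous L R′

    inWaste : ∀ {κ} → κ ∈ˡ L → Found ⊎ length (waste κ) ≤ coef s * b
    inWaste {κ} κ∈L with extract κ∈L
    ... | L′ , eq′ , _ , sup
      with homogenize s L′ (suc-injective (trans (sym eq′) eq)) b (waste κ) (waste-unique κ)
    ... | inj₂ small = inj₂ small
    ... | inj₁ (R′ , b<R′ , u′ , R′⊆ , hom) = inj₁ (R′ , b<R′ , u′ , waste⊆ κ ∘ R′⊆ , hom′)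
      where
      hom′ : Homogeneous L R′
      hom′ κ′∈L with sup κ′∈L
      ... | inj₁ refl  = inj₂ λ f∈ → immobile-⊆ R′⊆ (waste-immobile κ (R′⊆ f∈))
      ... | inj₂ κ′∈L′ = hom κ′∈L′

    go : Dec (b < length core) → Found ⊎ length R ≤ coef (suc s) * b
    go (yes b<core) = inj₁ (core , b<core , core-unique , core⊆ , λ κ∈L → inj₁ (core-mobile κ∈L))
    go (no  b≮core) with find-or-all L inWaste
    ... | inj₁ found = inj₁ found
    ... | inj₂ small = inj₂ (begin
      length R                                     ≤⟨ length-≤ ⟩
      length core + sum (map (length ∘ waste) L)   ≤⟨ +-mono-≤ (≮⇒≥ b≮core) (sum-map-≤ (length ∘ waste) L small) ⟩
      b + length L * (coef s * b)                  ≡⟨ cong (λ l → b + l * (coef s * b)) eq ⟩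
      b + suc s * (coef s * b)                     ≡⟨ cong (b +_) (*-assoc (suc s) (coef s) b) ⟨
      b + suc s * coef s * b                       ∎)
      where open ≤-Reasoning

-- Subsets as lists, and greedy choice of disjoint vertex sets.

_∈ˡ?_ : ∀ {n} (x : Fin n) xs → Dec (x ∈ˡ xs)
x ∈ˡ? xs = any? (x Fin.≟_) xs

length-map-allFin : ∀ {A : Set} {m} (f : Fin m → A) → length (map f (allFin m)) ≡ m
length-map-allFin {m = m} f = trans (length-map f (allFin m)) (length-tabulate id)

elements : ∀ {n} → Subset n → List (Fin n)
elements []            = []
elements (inside ∷ p)  = zero ∷ map suc (elements p)
elements (outside ∷ p) = map suc (elements p)

length-elements : ∀ {n} (p : Subset n) → length (elements p) ≡ ∣ p ∣
length-elements []            = refl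
length-elements (inside ∷ p)  = cong suc (trans (length-map suc (elements p)) (length-elements p))
length-elements (outside ∷ p) = trans (length-map suc (elements p)) (length-elements p)

∈-elements⁺ : ∀ {n} {p : Subset n} {x} → x ∈ p → x ∈ˡ elements p
∈-elements⁺ {p = inside ∷ p}  here         = here refl
∈-elements⁺ {p = inside ∷ p}  (there x∈p) = there (∈-map⁺ suc (∈-elements⁺ x∈p))
∈-elements⁺ {p = outside ∷ p} (there x∈p) = ∈-map⁺ suc (∈-elements⁺ x∈p)

∈-elements⁻ : ∀ {n} {p : Subset n} {x} → x ∈ˡ elements p → x ∈ p
∈-elements⁻ {p = inside ∷ p}  (here refl) = here
∈-elements⁻ {p = inside ∷ p}  (there x∈) with _ , y∈ , refl ← ∈-map⁻ suc x∈ = there (∈-elements⁻ y∈)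
∈-elements⁻ {p = outside ∷ p} x∈ with _ , y∈ , refl ← ∈-map⁻ suc x∈ = there (∈-elements⁻ y∈)

-- After each choice its new vertices join the forbidden list, which therefore never exceeds
-- `length W₀ + m * b`.
greedy : ∀ {n w b} {X : Set} (new : X → List (Fin n)) → (∀ x → length (new x) ≤ b) →
  ∀ m (Q : Fin m → X → Set) W₀ → length W₀ + m * b ≤ w →
  (∀ s W → length W ≤ w → ∃ λ x → Q s x × (∀ {v} → v ∈ˡ new x → v ∉ˡ W)) →
  ∃ λ (x : Fin m → X) →
    (∀ s → Q s (x s)) ×
    (∀ s {v} → v ∈ˡ new (x s) → v ∉ˡ W₀) ×
    (∀ s s′ {v} → v ∈ˡ new (x s) → v ∈ˡ new (x s′) → s ≡ s′)
greedy new new≤b zero Q W₀ fits choose = (λ ()) , (λ ()) , (λ ()) , λ ()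
greedy {n} {w} {b} {X} new new≤b (suc m) Q W₀ fits choose
  with x₀ , q₀ , fresh₀ ← choose zero W₀ (≤-trans (m≤m+n _ _) fits) =
  extend (greedy {w = w} new new≤b m (Q ∘ suc) (new x₀ ++ W₀) fits′ (choose ∘ suc))
  where
  fits′ : length (new x₀ ++ W₀) + m * b ≤ w
  fits′ = begin
    length (new x₀ ++ W₀) + m * b       ≡⟨ cong (_+ m * b) (trans (length-++ (new x₀)) (+-comm _ (length W₀))) ⟩
    length W₀ + length (new x₀) + m * b ≡⟨ +-assoc (length W₀) _ _ ⟩
    length W₀ + (length (new x₀) + m * b) ≤⟨ +-monoʳ-≤ (length W₀) (+-monoˡ-≤ (m * b) (new≤b x₀)) ⟩
    length W₀ + (b + m * b)             ≤⟨ fits ⟩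
    w                                   ∎
    where open ≤-Reasoning
  extend : (∃ λ (x : Fin m → X) →
      (∀ s → Q (suc s) (x s)) ×
      (∀ s {v} → v ∈ˡ new (x s) → v ∉ˡ new x₀ ++ W₀) ×
      (∀ s s′ {v} → v ∈ˡ new (x s) → v ∈ˡ new (x s′) → s ≡ s′)) → _
  extend (x , q , fresh , disjoint) = x′ , q′ , fresh′ , disjoint′
    where
    x′ : Fin (suc m) → X
    x′ zero    = x₀
    x′ (suc s) = x s
    q′ : ∀ s → Q s (x′ s)
    q′ zero    = q₀
    q′ (suc s) = q s
    fresh′ : ∀ s {v} → v ∈ˡ new (x′ s) → v ∉ˡ W₀
    fresh′ zero    v∈ = fresh₀ v∈
    fresh′ (suc s) v∈ = fresh s v∈ ∘ ∈-++⁺ʳ (new x₀)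
    disjoint′ : ∀ s s′ {v} → v ∈ˡ new (x′ s) → v ∈ˡ new (x′ s′) → s ≡ s′
    disjoint′ zero    zero     _  _   = refl
    disjoint′ zero    (suc s′) v∈ v∈′ = ⊥-elim (fresh s′ v∈′ (∈-++⁺ˡ v∈))
    disjoint′ (suc s) zero     v∈ v∈′ = ⊥-elim (fresh s v∈ (∈-++⁺ˡ v∈′))
    disjoint′ (suc s) (suc s′) v∈ v∈′ = cong suc (disjoint s s′ v∈ v∈′)

-- Building a linear path edge by edge.

∣p∩q∣≡1 : ∀ {n} {p q : Subset n} {x} → x ∈ p → x ∈ q → (∀ {v} → v ∈ p → v ∈ q → v ≡ x) → ∣ p ∩ q ∣ ≡ 1
∣p∩q∣≡1 {p = p} {q} {x} x∈p x∈q only =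
  trans (cong ∣_∣ (⊆-antisym
    (λ v∈ → let v∈p , v∈q = x∈p∩q⁻ p q v∈ in subst (_∈ ⁅ x ⁆) (sym (only v∈p v∈q)) (x∈⁅x⁆ x))
    (λ v∈ → subst (_∈ p ∩ q) (sym (x∈⁅y⁆⇒x≡y x v∈)) (x∈p∩q⁺ (x∈p , x∈q)))))
    (∣⁅x⁆∣≡1 x)

∣p∩q∣≡0 : ∀ {n} {p q : Subset n} → (∀ {v} → v ∈ p → v ∉ q) → ∣ p ∩ q ∣ ≡ 0
∣p∩q∣≡0 {n} {p} {q} disjoint =
  trans (cong ∣_∣ (Empty-unique {p = p ∩ q} (λ (_ , v∈) → let v∈p , v∈q = x∈p∩q⁻ p q v∈ in disjoint v∈p v∈q))) (∣⊥∣≡0 n)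

-- The common frame of `full-path` and `loose-path`: a state is an edge with a marked vertex, its
-- exit, through which the path continues. `W` will hold all vertices used so far, the exit
-- included, so the next edge may meet `W` in the exit alone.
module Walk {n k} (F : KFamily n k) {S : Set} (w : ℕ)
  (edge : S → Subset n) (exit : S → Fin n)
  (edge∈F : ∀ s → edge s ∈F F)
  (exit∈edge : ∀ s → exit s ∈ edge s)
  (step : ∀ s W → length W ≤ w → ∃ λ s′ → exit s ∈ edge s′ ×
    (∀ {v} → v ∈ edge s′ → v ∈ˡ W → v ≡ exit s) × exit s′ ∉ˡ W)
  where

  record Walked (r : ℕ) : Set where
    field
      E        : Fin (suc r) → Subset n
      E∈F      : ∀ i → E i ∈F F
      adjacent : ∀ i j → suc (toℕ i) ≡ toℕ j → ∣ E i ∩ E j ∣ ≡ 1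
      distant  : ∀ i j → suc (suc (toℕ i)) ≤ toℕ j → ∣ E i ∩ E j ∣ ≡ 0
      state    : S
      E-zero   : E zero ≡ edge state
      -- The exit lies in no edge but the newest, which makes the next edge disjoint from all older
      -- ones.
      exit∉    : ∀ i → exit state ∉ E (suc i)
      used     : List (Fin n)
      used≤    : length used ≤ suc r * k
      used⊇    : ∀ i {v} → v ∈ E i → v ∈ˡ used

  length-edge : ∀ s → length (elements (edge s)) ≡ k
  length-edge s = trans (length-elements (edge s)) (All.lookup (uniform F) (edge∈F s))

  -- The path grows at its head: E zero is the newest edge.
  walk : S → ∀ r → r * k ≤ w → Walked r
  walk s zero _ = record
    { E = λ _ → edge s ; E∈F = λ _ → edge∈F s
    ; adjacent = λ { zero zero () } ; distant = λ { zero zero () }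
    ; state = s ; E-zero = refl ; exit∉ = λ ()
    ; used = elements (edge s)
    ; used≤ = ≤-reflexive (trans (length-edge s) (sym (+-identityʳ k)))
    ; used⊇ = λ _ → ∈-elements⁺ }
  walk s (suc r) fits = record
    { E = E′ ; E∈F = E′∈F ; adjacent = adjacent′ ; distant = distant′
    ; state = s′ ; E-zero = refl ; exit∉ = λ i v∈ → exit∉′ (used⊇ i v∈)
    ; used = elements (edge s′) ++ used ; used≤ = used≤′ ; used⊇ = used⊇′ }
    where
    open Walked (walk s r (≤-trans (m≤n+m (r * k) k) fits))
    next = step state used (≤-trans used≤ fits)
    s′ : S
    s′ = proj₁ next
    exit∈edge′ : exit state ∈ edge s′
    exit∈edge′ = proj₁ (proj₂ next)
    only-exit : ∀ {v} → v ∈ edge s′ → v ∈ˡ used → v ≡ exit state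
    only-exit = proj₁ (proj₂ (proj₂ next))
    exit∉′ : exit s′ ∉ˡ used
    exit∉′ = proj₂ (proj₂ (proj₂ next))
    E′ : Fin (suc (suc r)) → Subset n
    E′ zero    = edge s′
    E′ (suc i) = E i
    E′∈F : ∀ i → E′ i ∈F F
    E′∈F zero    = edge∈F s′
    E′∈F (suc i) = E∈F i
    adjacent′ : ∀ i j → suc (toℕ i) ≡ toℕ j → ∣ E′ i ∩ E′ j ∣ ≡ 1
    adjacent′ zero    (suc zero) _ = ∣p∩q∣≡1 exit∈edge′ (subst (exit state ∈_) (sym E-zero) (exit∈edge state))
                                       (λ v∈ v∈′ → only-exit v∈ (used⊇ zero v∈′))
    adjacent′ (suc i) (suc j) eq   = adjacent i j (suc-injective eq)
    distant′ : ∀ i j → suc (suc (toℕ i)) ≤ toℕ j → ∣ E′ i ∩ E′ j ∣ ≡ 0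
    distant′ zero    (suc zero)    (s≤s ())
    distant′ zero    (suc (suc j)) _ = ∣p∩q∣≡0 λ v∈ v∈′ →
      exit∉ j (subst (_∈ E (suc j)) (only-exit v∈ (used⊇ (suc j) v∈′)) v∈′)
    distant′ (suc i) (suc j) (s≤s le) = distant i j le
    used≤′ : length (elements (edge s′) ++ used) ≤ suc (suc r) * k
    used≤′ = ≤-trans (≤-reflexive (length-++ (elements (edge s′))))
      (+-mono-≤ (≤-reflexive (length-edge s′)) used≤)
    used⊇′ : ∀ i {v} → v ∈ E′ i → v ∈ˡ elements (edge s′) ++ used
    used⊇′ zero    v∈ = ∈-++⁺ˡ (∈-elements⁺ v∈)
    used⊇′ (suc i) v∈ = ∈-++⁺ʳ (elements (edge s′)) (used⊇ i v∈)

  linearPath : ∀ ℓ → ℓ * k ≤ w → S → ContainsPath ℓ F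
  linearPath zero    _    s = (λ ()) , (λ ()) , (λ ()) , λ ()
  linearPath (suc r) fits s = E , E∈F , adjacent , distant
    where open Walked (walk s r (≤-trans (m≤n+m (r * k) k) fits))

-- The moves on sets with many extensions.

moveCount : ℕ → ℕ → ℕ
moveCount d t = length (cartesianProduct (allFin (3 + d)) (upTo (2 + t)))

-- ds f lists the k-1 = 3+d vertices of f and zs f 0, …, zs f t are vertices extending f to an edge;
-- zs f i is junk for i > t.
module Extensions {n d t : ℕ} {A : Set} (w : ℕ) .{{_ : NonZero w}}
  (ds : A → Fin (3 + d) → Fin n) (zs : A → ℕ → Fin n)
  where

  Move : Set
  Move = Fin (3 + d) × ℕ

  -- The move (j , i) replaces the vertex ds f j and, if i ≤ t, also zs f i, keeping
  -- the other vertices of f and zs f i′ for i′ < i; nothing is said on zs f i′ for i′ > i.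
  Keep : Move → A → A → Set
  Keep (j , i) f g = (∀ j′ → j′ ≢ j → ds f j′ ≡ ds g j′) × (∀ {i′} → i′ < i → zs f i′ ≡ zs g i′)

  Hit : Move → List (Fin n) → A → Set
  Hit (j , i) W g = ds g j ∈ˡ W ⊎ (i < suc t × zs g i ∈ˡ W)

  Keep? : ∀ κ f g → Dec (Keep κ f g)
  Keep? (j , i) f g =
    Fin.all? (λ j′ → ¬? (j′ Fin.≟ j) →-dec (ds f j′ Fin.≟ ds g j′)) ×-dec
    allUpTo? (λ i′ → zs f i′ Fin.≟ zs g i′) i

  Hit? : ∀ κ W g → Dec (Hit κ W g)
  Hit? (j , i) W g = (ds g j ∈ˡ? W) ⊎-dec ((i <? suc t) ×-dec (zs g i ∈ˡ? W))

  open Moves {A} {Move} {n} w (≡-dec Fin._≟_ _≟_) Keep Keep?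
    ((λ _ _ → refl) , λ _ → refl)
    (λ (p , q) → (λ j′ ne → sym (p j′ ne)) , λ lt → sym (q lt))
    (λ (p , q) (p′ , q′) → (λ j′ ne → trans (p j′ ne) (p′ j′ ne)) , λ lt → trans (q lt) (q′ lt))
    Hit Hit? public

  -- The positions in `js` are fixed one at a time, with `n` possible vertices for each.
  length-grouped : ∀ {b} js xs → Unique xs →
    (∀ {ys} → Unique ys → ys ⊆ˡ xs → (∀ {f g j} → f ∈ˡ ys → g ∈ˡ ys → j ∈ˡ js → ds f j ≡ ds g j) → length ys ≤ b) →
    length xs ≤ n ^ length js * b
  length-grouped {b} [] xs u bound =
    ≤-trans (bound u id (λ _ _ ())) (≤-reflexive (sym (+-identityʳ b)))
  length-grouped {b} (j ∷ js) xs u bound = subst (length xs ≤_) eq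
    (cover-length (λ v f → ds f j Fin.≟ v) (allFin n) xs u (λ {f} _ → lose (∈-allFin (ds f j)) refl)
      (λ {v} {ys} _ u′ ys⊆ q → length-grouped js ys u′ (λ u″ zs⊆ same → bound u″ (ys⊆ ∘ zs⊆)
        λ { f∈ g∈ (here refl) → trans (q (zs⊆ f∈)) (sym (q (zs⊆ g∈)))
          ; f∈ g∈ (there j∈)  → same f∈ g∈ j∈ })))
    where
    eq : length (allFin n) * (n ^ length js * b) ≡ n * n ^ length js * b
    eq = trans (cong (_* (n ^ length js * b)) (length-tabulate {n = n} id)) (sym (*-assoc n _ b))

  module _ {Sh : List A} (ds-determine : ∀ {f g} → f ∈ˡ Sh → g ∈ˡ Sh → (∀ j → ds f j ≡ ds g j) → f ≡ g) where

    private
      branching : ℕ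
      branching = w + w

    -- The members of `xs` agree off position `j` and on the first `i` extensions. One list `W`
    -- blocks the move `(j , i)` for all of them, so every `g` in `xs` has `ds g j` or `zs g i` in
    -- `W`, which makes at most `w + w` causes. Fixing `ds g j` determines `g`; fixing `zs g i`
    -- gives agreement on one more extension and leads to `i + 1`.
    length-fibre : ∀ {R j} → R ⊆ˡ Sh → (∀ i {f} → i ≤ suc t → f ∈ˡ R → Immobile (j , i) R f) →
      ∀ r i xs → i + r ≡ suc t → Unique xs → xs ⊆ˡ R →
      (∀ {f g} → f ∈ˡ xs → g ∈ˡ xs → Keep (j , i) f g) →
      length xs ≤ branching ^ suc r
    length-fibre _ _ r i [] _ _ _ _ = z≤n
    length-fibre {R} {j} R⊆ immobile r i xs@(f ∷ _) i+r≡ u xs⊆ keep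
      with W , W≤w , hit ← immobile i (≤-trans (m≤m+n i r) (≤-reflexive i+r≡)) (xs⊆ (here refl)) =
      ≤-trans (cover-length Q? causes xs u cov bound) (*-monoˡ-≤ (branching ^ r) causes≤)
      where
      instance
        branching≢0 : NonZero branching
        branching≢0 = >-nonZero (≤-trans (>-nonZero⁻¹ w) (m≤m+n w w))
      Q : Fin n ⊎ Fin n → A → Set
      Q (inj₁ v) g = ds g j ≡ v
      Q (inj₂ v) g = i < suc t × zs g i ≡ v
      Q? : ∀ c g → Dec (Q c g)
      Q? (inj₁ v) g = ds g j Fin.≟ v
      Q? (inj₂ v) g = (i <? suc t) ×-dec (zs g i Fin.≟ v)
      causes : List (Fin n ⊎ Fin n)
      causes = map inj₁ W ++ map inj₂ W
      causes≤ : length causes ≤ branching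
      causes≤ = ≤-trans (≤-reflexive (trans (length-++ (map inj₁ W)) (cong₂ _+_ (length-map inj₁ W) (length-map inj₂ W))))
        (+-mono-≤ W≤w W≤w)
      cov : ∀ {g} → g ∈ˡ xs → Any (λ c → Q c g) causes
      cov g∈ with hit (xs⊆ g∈) (keep (here refl) g∈)
      ... | inj₁ d∈W        = lose (∈-++⁺ˡ (∈-map⁺ inj₁ d∈W)) refl
      ... | inj₂ (i<t , z∈W) = lose (∈-++⁺ʳ (map inj₁ W) (∈-map⁺ inj₂ z∈W)) (i<t , refl)
      next : ∀ r {v ys} → i + r ≡ suc t → Unique ys → ys ⊆ˡ xs → (∀ {g} → g ∈ˡ ys → i < suc t × zs g i ≡ v) →
        length ys ≤ branching ^ r
      next _ {ys = []} _ _ _ _ = z≤n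
      -- Here `i = t + 1`, and a move of that index replaces no extension.
      next zero {ys = _ ∷ _} i+0≡ _ _ q = contradiction (proj₁ (q (here refl)))
        (<-irrefl (trans (sym (+-identityʳ i)) i+0≡))
      next (suc r) {ys = ys} i+r≡ u′ ys⊆ q =
        length-fibre R⊆ immobile r (suc i) ys (trans (sym (+-suc i r)) i+r≡) u′ (xs⊆ ∘ ys⊆) keep′
        where
        keep′ : ∀ {f g} → f ∈ˡ ys → g ∈ˡ ys → Keep (j , suc i) f g
        keep′ {f} {g} f∈ g∈ = proj₁ old , λ i′≤i → [ proj₂ old , (λ { refl → same }) ]′ (m<1+n⇒m<n∨m≡n i′≤i)
          where
          old = keep (ys⊆ f∈) (ys⊆ g∈)
          same : zs f i ≡ zs g i
          same = trans (proj₂ (q f∈)) (sym (proj₂ (q g∈)))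
      bound : ∀ {c ys} → c ∈ˡ causes → Unique ys → ys ⊆ˡ xs → (∀ {g} → g ∈ˡ ys → Q c g) → length ys ≤ branching ^ r
      bound {inj₁ v} {ys} _ u′ ys⊆ q = ≤-trans (length≤1 u′ same) (m^n>0 branching r)
        where
        same : ∀ {f g} → f ∈ˡ ys → g ∈ˡ ys → f ≡ g
        same {f} {g} f∈ g∈ = ds-determine (R⊆ (xs⊆ (ys⊆ f∈))) (R⊆ (xs⊆ (ys⊆ g∈))) agree
          where
          agree : ∀ j′ → ds f j′ ≡ ds g j′
          agree j′ with j′ Fin.≟ j
          ... | yes refl = trans (q f∈) (sym (q g∈))
          ... | no  j′≢j = proj₁ (keep (ys⊆ f∈) (ys⊆ g∈)) j′ j′≢j
      bound {inj₂ v} _ u′ ys⊆ q = next r i+r≡ u′ ys⊆ q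

    -- The `2 + d` vertices off position `j` are fixed first; the members sharing them form a fibre
    -- to which `length-fibre` applies from `i = 0`.
    immobile-length : ∀ {R j} → Unique R → R ⊆ˡ Sh → (∀ i {f} → i ≤ suc t → f ∈ˡ R → Immobile (j , i) R f) →
      length R ≤ n ^ (2 + d) * (w + w) ^ (2 + t)
    immobile-length {R} {j} u R⊆ immobile =
      subst (λ e → length R ≤ n ^ e * (w + w) ^ (2 + t)) (length-map-allFin (punchIn j))
        (length-grouped others R u λ {ys} u′ ys⊆ same →
          length-fibre R⊆ immobile (suc t) 0 ys refl u′ ys⊆
            (λ f∈ g∈ → (λ j′ j′≢j → same f∈ g∈ (j′∈others j′≢j)) , λ ()))
      where
      others : List (Fin (3 + d))
      others = map (punchIn j) (allFin (2 + d))
      j′∈others : ∀ {j′} → j′ ≢ j → j′ ∈ˡ others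
      j′∈others j′≢j = subst (_∈ˡ others) (Fin.punchIn-punchOut (j′≢j ∘ sym))
        (∈-map⁺ (punchIn j) (∈-allFin (punchOut (j′≢j ∘ sym))))

    -- `homogenize` is run with `b` equal to the bound of `immobile-length`. The homogeneous family
    -- it returns is larger than `b`, so at no position can all moves be immobile.
    mobile-core : coef (moveCount d t) * (n ^ (2 + d) * (w + w) ^ (2 + t)) < length Sh → Unique Sh →
      ∃ λ R → 0 < length R × R ⊆ˡ Sh ×
        (∀ j → ∃ λ i → i ≤ suc t × (∀ {f} → f ∈ˡ R → Mobile (j , i) R f))
    mobile-core big u with homogenize (moveCount d t) (cartesianProduct (allFin (3 + d)) (upTo (2 + t))) refl _ Sh u
    ... | inj₂ small = contradiction small (<⇒≱ big)
    ... | inj₁ (R , bR , uR , R⊆ , hom) = R , ≤-trans (s≤s z≤n) bR , R⊆ , choice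
      where
      Goal : Fin (3 + d) → Set
      Goal j = ∃ λ i → i ≤ suc t × (∀ {f} → f ∈ˡ R → Mobile (j , i) R f)
      choice : ∀ j → Goal j
      choice j with find-or-all {P = Goal j} {Q = λ i → ∀ {f} → f ∈ˡ R → Immobile (j , i) R f} (upTo (2 + t)) search
        where
        search : ∀ {i} → i ∈ˡ upTo (2 + t) → Goal j ⊎ (∀ {f} → f ∈ˡ R → Immobile (j , i) R f)
        search {i} i∈ with hom (∈-cartesianProduct⁺ (∈-allFin j) i∈)
        ... | inj₁ mobile   = inj₁ (i , s≤s⁻¹ (∈-upTo⁻ i∈) , mobile)
        ... | inj₂ immobile = inj₂ immobile
      ... | inj₁ goal     = goal
      ... | inj₂ immobile = contradiction
        (immobile-length uR R⊆ (λ i i≤ → immobile (∈-upTo⁺ (s≤s i≤)))) (<⇒≱ bR)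

  -- One move is made at each position of `js` in turn. A move at `j` keeps the vertices at the
  -- other positions, so those already renewed stay outside `W`. The extension `zs f i` survives if
  -- its index lies below those of all the moves.
  moves : ∀ {R} (I : Fin (3 + d) → ℕ) → (∀ j {f} → f ∈ˡ R → Mobile (j , I j) R f) →
    ∀ js {f} W → length W ≤ w → f ∈ˡ R →
    ∃ λ g → g ∈ˡ R × (∀ {j} → j ∈ˡ js → ds g j ∉ˡ W) × (∀ {j} → j ∉ˡ js → ds f j ≡ ds g j) ×
      (∀ {i} → (∀ j → i < I j) → zs f i ≡ zs g i)
  moves I mobile [] {f} W W≤w f∈ = f , f∈ , (λ ()) , (λ _ → refl) , λ _ → refl
  moves I mobile (j ∷ js) {f} W W≤w f∈
    with g , g∈ , out , same , sameZ ← moves I mobile js W W≤w f∈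
    with h , h∈ , (keepD , keepZ) , ¬hit ← mobile j g∈ W W≤w =
    h , h∈ , out′ , (λ j′∉ → trans (same (j′∉ ∘ there)) (keepD _ (j′∉ ∘ here))) ,
    λ i<I → trans (sameZ i<I) (keepZ (i<I j))
    where
    out′ : ∀ {j′} → j′ ∈ˡ j ∷ js → ds h j′ ∉ˡ W
    out′ {j′} j′∈ with j′ Fin.≟ j
    ... | yes refl = ¬hit ∘ inj₁
    out′ (here refl) | no j′≢j = contradiction refl j′≢j
    out′ (there j′∈) | no j′≢j = subst (_∉ˡ W) (keepD _ j′≢j) (out j′∈)

  -- Paths and blowups from mobile moves.

  module Embedding {k} (F : KFamily n k) (edge : A → ℕ → Subset n) {R : List A}
    (edge∈F : ∀ {f i} → f ∈ˡ R → i < suc t → edge f i ∈F F)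
    (ds∈edge : ∀ {f i} → f ∈ˡ R → ∀ j → ds f j ∈ edge f i)
    (zs∈edge : ∀ {f i} → zs f i ∈ edge f i)
    (edge⁻ : ∀ {f i v} → f ∈ˡ R → v ∈ edge f i → v ≡ zs f i ⊎ ∃ λ j → v ≡ ds f j)
    where

    -- If the move at j₀ replaces zs f i, the edges f ∪ {zs f i} form a linear path alternating
    -- between two joint positions other than j₀. The move at j₀ comes last: the others
    -- may set zs f i to a forbidden vertex.
    loose-path : (I : Fin (3 + d) → ℕ) → (∀ j {f} → f ∈ˡ R → Mobile (j , I j) R f) →
      ∀ j₀ → I j₀ < suc t → 0 < length R → ∀ ℓ → ℓ * k ≤ w → ContainsPath ℓ F
    loose-path I mobile j₀ I<t R≢[] ℓ fits = W.linearPath ℓ fits (start R≢[])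
      where
      State : Set
      State = (∃ λ f → f ∈ˡ R) × Bool
      start : 0 < length R → State
      start = go R id
        where
        go : ∀ xs → (∀ {f} → f ∈ˡ xs → f ∈ˡ R) → 0 < length xs → State
        go (f ∷ _) sub _ = (f , sub (here refl)) , false
      -- There are `3 + d` positions, so at least two besides `j₀`.
      c : Bool → Fin (3 + d)
      c false = punchIn j₀ zero
      c true  = punchIn j₀ (suc zero)
      c≢j₀ : ∀ b → c b ≢ j₀
      c≢j₀ false = Fin.punchInᵢ≢i j₀ zero
      c≢j₀ true  = Fin.punchInᵢ≢i j₀ (suc zero)
      c-not≢ : ∀ b → c (not b) ≢ c b
      c-not≢ false eq with () ← Fin.punchIn-injective j₀ _ _ eq
      c-not≢ true  eq with () ← Fin.punchIn-injective j₀ _ _ eq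
      other? : ∀ b → Decidable (λ j → j ≢ j₀ × j ≢ c b)
      other? b j = ¬? (j Fin.≟ j₀) ×-dec ¬? (j Fin.≟ c b)
      edge′ : State → Subset n
      edge′ ((f , _) , _) = edge f (I j₀)
      exit : State → Fin n
      exit ((f , _) , b) = ds f (c b)
      step : ∀ s W → length W ≤ w → ∃ λ s′ → exit s ∈ edge′ s′ ×
        (∀ {v} → v ∈ edge′ s′ → v ∈ˡ W → v ≡ exit s) × exit s′ ∉ˡ W
      step ((f , f∈) , b) W W≤w
        with g , g∈ , out , same , _ ← moves I mobile (filter (other? b) (allFin (3 + d))) W W≤w f∈
        with h , h∈ , (keepD , _) , ¬hit ← mobile j₀ g∈ W W≤w =
        ((h , h∈) , not b) , subst (_∈ edge h (I j₀)) (sym same-exit) (ds∈edge h∈ (c b)) , only ,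
        other (c≢j₀ (not b)) (c-not≢ b)
        where
        same-exit : ds f (c b) ≡ ds h (c b)
        same-exit = trans
          (same (λ cb∈ → proj₂ (proj₂ (∈-filter⁻ (other? b) {xs = allFin (3 + d)} cb∈)) refl))
          (keepD (c b) (c≢j₀ b))
        other : ∀ {j} → j ≢ j₀ → j ≢ c b → ds h j ∉ˡ W
        other {j} j≢j₀ j≢cb = subst (_∉ˡ W) (keepD j j≢j₀) (out (∈-filter⁺ (other? b) (∈-allFin j) (j≢j₀ , j≢cb)))
        only : ∀ {v} → v ∈ edge h (I j₀) → v ∈ˡ W → v ≡ ds f (c b)
        only v∈ v∈W with edge⁻ h∈ v∈
        ... | inj₁ refl = contradiction (inj₂ (I<t , v∈W)) ¬hit
        ... | inj₂ (j , refl) with j Fin.≟ j₀ | j Fin.≟ c b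
        ...   | yes refl | _        = contradiction (inj₁ v∈W) ¬hit
        ...   | no  _    | yes refl = sym same-exit
        ...   | no j≢j₀  | no j≢cb  = contradiction v∈W (other j≢j₀ j≢cb)
      module W = Walk F w edge′ exit (λ ((_ , f∈) , _) → edge∈F f∈ I<t) (λ ((_ , f∈) , b) → ds∈edge f∈ (c b)) step

    -- Moves of index `t + 1` preserve `zs f 0`, ..., `zs f t`, which become the `t + 1` vertices of
    -- one side. First `q` members with these extensions and distinct vertices at position `zero`
    -- are chosen; those vertices form the other side. Then, for each pair, all positions but `zero`
    -- are renewed, which supplies its `2 + d` private vertices. `fits` counts the core and all
    -- private vertices.
    tight-blowup : (∀ {f i i′} → f ∈ˡ R → i < suc t → i′ < suc t → zs f i ≡ zs f i′ → i ≡ i′) →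
      (∀ {f i j} → f ∈ˡ R → i < suc t → zs f i ≢ ds f j) →
      (∀ j {f} → f ∈ˡ R → Mobile (j , suc t) R f) →
      ∀ {f} → f ∈ˡ R → ∀ q → suc t + q + suc t * q * (2 + d) ≤ w → ContainsBlowupK t q F
    tight-blowup zs-injective zs≢ds mobile {f} f∈ q fits
      with g , g-zs , _ , g-distinct ← greedy {w = w} {b = 1} {X = ∃ λ g → g ∈ˡ R} (λ (g , _) → ds g zero ∷ []) (λ _ → ≤-refl) q
        (λ _ (g , _) → ∀ {i} → i < suc t → zs f i ≡ zs g i) []
        (≤-trans (≤-reflexive (*-identityʳ q)) (≤-trans (m≤n+m q (suc t)) (≤-trans (m≤m+n _ _) fits)))
        (λ _ W W≤w → let g , g∈ , out , _ , sameZ = moves (λ _ → suc t) mobile (allFin (3 + d)) W W≤w f∈ in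
          (g , g∈) , (λ i<t → sameZ (λ _ → i<t)) , λ { (here refl) → out (∈-allFin zero) })
      = blowup g g-zs (λ j j′ eq → g-distinct j j′ (here refl) (here eq))
      where
      blowup : (g : Fin q → ∃ λ g → g ∈ˡ R) → (∀ j {i} → i < suc t → zs f i ≡ zs (proj₁ (g j)) i) →
        (∀ j j′ → ds (proj₁ (g j)) zero ≡ ds (proj₁ (g j′)) zero → j ≡ j′) → ContainsBlowupK t q F
      blowup g g-zs g-distinct =
        a , b , E , (λ eq → Fin.toℕ-injective (zs-injective f∈ (Fin.toℕ<n _) (Fin.toℕ<n _) eq)) , g-distinct _ _ ,
        (λ i j eq → zs≢ds (proj₂ (g j)) (Fin.toℕ<n i) (trans (sym (g-zs j (Fin.toℕ<n i))) eq)) ,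
        (λ i j → edge∈F (proj₂ (h i j)) (Fin.toℕ<n i)) ,
        (λ i j → subst (_∈ E i j) (sym (h-zs i j)) zs∈edge) ,
        (λ i j → subst (_∈ E i j) (sym (h-ds i j)) (ds∈edge (proj₂ (h i j)) zero)) ,
        private-part
        where
        a : Fin (suc t) → Fin n
        a i = zs f (toℕ i)
        b : Fin q → Fin n
        b j = ds (proj₁ (g j)) zero
        new : (∃ λ h → h ∈ˡ R) → List (Fin n)
        new (h , _) = map (ds h ∘ suc) (allFin (2 + d))
        core : List (Fin n)
        core = map a (allFin (suc t)) ++ map b (allFin q)
        -- Of the pair coded by `s` only the second index is constrained here; the first enters when
        -- `E i j` attaches the extension of index `i`.
        Q : Fin (suc t * q) → (∃ λ h → h ∈ˡ R) → Set
        Q s (h , _) = (∀ {i} → i < suc t → zs f i ≡ zs h i) × b (proj₂ (remQuot {suc t} q s)) ≡ ds h zero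
        core-length : length core ≡ suc t + q
        core-length = trans (length-++ (map a (allFin (suc t)))) (cong₂ _+_ (length-map-allFin a) (length-map-allFin b))
        rest : List (Fin (3 + d))
        rest = map suc (allFin (2 + d))
        chosen = greedy {w = w} {b = 2 + d} {X = ∃ λ h → h ∈ˡ R} new
          (λ (h , _) → ≤-reflexive (length-map-allFin (ds h ∘ suc)))
          (suc t * q) Q core (subst (λ l → l + suc t * q * (2 + d) ≤ w) (sym core-length) fits)
          (λ s W W≤w →
            let j = proj₂ (remQuot {suc t} q s)
                h , h∈ , out , same , sameZ = moves (λ _ → suc t) mobile rest W W≤w (proj₂ (g j)) in
            (h , h∈) , ((λ i<t → trans (g-zs j i<t) (sameZ (λ _ → i<t))) , same zero∉rest) ,
            λ v∈ → let j′ , j′∈ , eq = ∈-map⁻ (ds h ∘ suc) v∈ in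
              subst (_∉ˡ W) (sym eq) (out (∈-map⁺ suc j′∈)))
          where
          zero∉rest : zero ∉ˡ rest
          zero∉rest z∈ with _ , _ , () ← ∈-map⁻ suc z∈
        h : Fin (suc t) → Fin q → ∃ λ h → h ∈ˡ R
        h i j = proj₁ chosen (combine i j)
        h-zs : ∀ i j → a i ≡ zs (proj₁ (h i j)) (toℕ i)
        h-zs i j = proj₁ (proj₁ (proj₂ chosen) (combine i j)) (Fin.toℕ<n i)
        h-ds : ∀ i j → b j ≡ ds (proj₁ (h i j)) zero
        h-ds i j = trans (cong (b ∘ proj₂) (sym (Fin.remQuot-combine i j))) (proj₂ (proj₁ (proj₂ chosen) (combine i j)))
        E : Fin (suc t) → Fin q → Subset n
        E i j = edge (proj₁ (h i j)) (toℕ i)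
        E⁻ : ∀ i j {v} → v ∈ E i j → v ≢ a i → v ≢ b j → v ∈ˡ new (h i j)
        E⁻ i j {v} v∈ v≢a v≢b = go (edge⁻ (proj₂ (h i j)) v∈)
          where
          go : v ≡ zs (proj₁ (h i j)) (toℕ i) ⊎ (∃ λ j′ → v ≡ ds (proj₁ (h i j)) j′) → v ∈ˡ new (h i j)
          go (inj₁ v≡z)            = contradiction (trans v≡z (sym (h-zs i j))) v≢a
          go (inj₂ (zero , v≡d))   = contradiction (trans v≡d (sym (h-ds i j))) v≢b
          go (inj₂ (suc j′ , v≡d)) = subst (_∈ˡ new (h i j)) (sym v≡d) (∈-map⁺ _ (∈-allFin j′))
        private-part : ∀ i j v → v ∈ E i j → v ≢ a i → v ≢ b j →
          (∀ i′ → v ≢ a i′) × (∀ j′ → v ≢ b j′) × (∀ i′ j′ → v ∈ E i′ j′ → i′ ≡ i × j′ ≡ j)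
        private-part i j v v∈ v≢a v≢b = ≢a , ≢b , λ i′ j′ v∈′ →
          -- Being outside the core, `v` must be one of the new vertices of the edge at `(i′ , j′)`
          -- as well, and new vertices of distinct pairs are disjoint.
          let eq = proj₂ (proj₂ (proj₂ chosen)) (combine i′ j′) (combine i j) (E⁻ i′ j′ v∈′ (≢a i′) (≢b j′)) v∈new
          in Fin.combine-injective i′ j′ i j eq
          where
          v∈new : v ∈ˡ new (h i j)
          v∈new = E⁻ i j v∈ v≢a v≢b
          ∉core : v ∉ˡ core
          ∉core = proj₁ (proj₂ (proj₂ chosen)) (combine i j) v∈new
          ≢a : ∀ i′ → v ≢ a i′
          ≢a i′ refl = ∉core (∈-++⁺ˡ (∈-map⁺ a (∈-allFin i′)))
          ≢b : ∀ j′ → v ≢ b j′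
          ≢b j′ refl = ∉core (∈-++⁺ʳ (map a (allFin (suc t))) (∈-map⁺ b (∈-allFin j′)))

-- Deleting a vertex from a subset, and the subsets of a given size.

_≟ˢ_ : ∀ {n} (p q : Subset n) → Dec (p ≡ q)
_≟ˢ_ = Vec.≡-dec Bool._≟_

_∈ˡˢ?_ : ∀ {n} (p : Subset n) ps → Dec (p ∈ˡ ps)
p ∈ˡˢ? ps = any? (p ≟ˢ_) ps

x∈p─q⇒x∉q : ∀ {n} (p q : Subset n) {x} → x ∈ p ─ q → x ∉ q
x∈p─q⇒x∉q (_ ∷ p) (outside ∷ q) (there x∈) (there x∈q) = x∈p─q⇒x∉q p q x∈ x∈q
x∈p─q⇒x∉q (_ ∷ p) (inside  ∷ q) (there x∈) (there x∈q) = x∈p─q⇒x∉q p q x∈ x∈q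

x∉p-x : ∀ {n} (p : Subset n) x → x ∉ p - x
x∉p-x p x x∈ = x∈p─q⇒x∉q p ⁅ x ⁆ x∈ (x∈⁅x⁆ x)

∣p-x∣ : ∀ {n} {p : Subset n} {x} → x ∈ p → suc ∣ p - x ∣ ≡ ∣ p ∣
∣p-x∣ {p = inside ∷ p}  here       = cong (suc ∘ ∣_∣) (p─⊥≡p p)
∣p-x∣ {p = inside ∷ p}  (there x∈) = cong suc (∣p-x∣ x∈)
∣p-x∣ {p = outside ∷ p} (there x∈) = ∣p-x∣ x∈

p-x∪x : ∀ {n} {p : Subset n} {x} → x ∈ p → (p - x) ∪ ⁅ x ⁆ ≡ p
p-x∪x {p = p} {x} x∈p = ⊆-antisym to from
  where
  to : ∀ {y} → y ∈ (p - x) ∪ ⁅ x ⁆ → y ∈ p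
  to y∈ with x∈p∪q⁻ (p - x) ⁅ x ⁆ y∈
  ... | inj₁ y∈p-x = p─q⊆p p ⁅ x ⁆ y∈p-x
  ... | inj₂ y∈x   = subst (_∈ p) (sym (x∈⁅y⁆⇒x≡y x y∈x)) x∈p
  from : ∀ {y} → y ∈ p → y ∈ (p - x) ∪ ⁅ x ⁆
  from {y} y∈p with y Fin.≟ x
  ... | yes refl = x∈p∪q⁺ (inj₂ (x∈⁅x⁆ x))
  ... | no  y≢x  = x∈p∪q⁺ (inj₁ (x∈p∧x≢y⇒x∈p-y y∈p y≢x))

subsetsOfSize : ∀ n → ℕ → List (Subset n)
subsetsOfSize zero    zero    = [] ∷ []
subsetsOfSize zero    (suc _) = []
subsetsOfSize (suc n) zero    = map (outside ∷_) (subsetsOfSize n zero)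
subsetsOfSize (suc n) (suc k) = map (inside ∷_) (subsetsOfSize n k) ++ map (outside ∷_) (subsetsOfSize n (suc k))

nC0≡1 : ∀ n → n choose 0 ≡ 1
nC0≡1 n = trans (nCk≡nC[n∸k] {n = n} z≤n) (nCn≡1 n)

length-subsetsOfSize : ∀ n k → length (subsetsOfSize n k) ≡ n choose k
length-subsetsOfSize zero    zero    = refl
length-subsetsOfSize zero    (suc k) = refl
length-subsetsOfSize (suc n) zero    = trans (length-map _ (subsetsOfSize n zero))
  (trans (length-subsetsOfSize n zero) (trans (nC0≡1 n) (sym (nC0≡1 (suc n)))))
length-subsetsOfSize (suc n) (suc k) = begin
  length (map (inside ∷_) (subsetsOfSize n k) ++ map (outside ∷_) (subsetsOfSize n (suc k)))
    ≡⟨ length-++ (map (inside ∷_) (subsetsOfSize n k)) ⟩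
  length (map (inside ∷_) (subsetsOfSize n k)) + length (map (outside ∷_) (subsetsOfSize n (suc k)))
    ≡⟨ cong₂ _+_ (trans (length-map _ (subsetsOfSize n k)) (length-subsetsOfSize n k))
                 (trans (length-map _ (subsetsOfSize n (suc k))) (length-subsetsOfSize n (suc k))) ⟩
  n choose k + n choose suc k ≡⟨ nCk+nC[k+1]≡[n+1]C[k+1] n k ⟩
  suc n choose suc k     ∎
  where open ≡-Reasoning

∈-subsetsOfSize⁺ : ∀ {n} (p : Subset n) → p ∈ˡ subsetsOfSize n ∣ p ∣
∈-subsetsOfSize⁺ []           = here refl
∈-subsetsOfSize⁺ (inside ∷ p) = ∈-++⁺ˡ (∈-map⁺ (inside ∷_) (∈-subsetsOfSize⁺ p))
∈-subsetsOfSize⁺ (outside ∷ p) with ∣ p ∣ | ∈-subsetsOfSize⁺ p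
... | zero  | p∈ = ∈-map⁺ (outside ∷_) p∈
... | suc k | p∈ = ∈-++⁺ʳ (map (inside ∷_) (subsetsOfSize _ k)) (∈-map⁺ (outside ∷_) p∈)

∈-subsetsOfSize⁻ : ∀ {n k} {p : Subset n} → p ∈ˡ subsetsOfSize n k → ∣ p ∣ ≡ k
∈-subsetsOfSize⁻ {zero}  {zero}  (here refl) = refl
∈-subsetsOfSize⁻ {suc n} {zero}  p∈ with _ , q∈ , refl ← ∈-map⁻ (outside ∷_) p∈ = ∈-subsetsOfSize⁻ q∈
∈-subsetsOfSize⁻ {suc n} {suc k} p∈ with ∈-++⁻ (map (inside ∷_) (subsetsOfSize n k)) p∈
... | inj₁ p∈ˡ with _ , q∈ , refl ← ∈-map⁻ (inside ∷_) p∈ˡ  = cong suc (∈-subsetsOfSize⁻ q∈)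
... | inj₂ p∈ʳ with _ , q∈ , refl ← ∈-map⁻ (outside ∷_) p∈ʳ = ∈-subsetsOfSize⁻ q∈

subsetsOfSize-unique : ∀ n k → Unique (subsetsOfSize n k)
subsetsOfSize-unique zero    zero    = [] ∷ []
subsetsOfSize-unique zero    (suc k) = []
subsetsOfSize-unique (suc n) zero    = Unique.map⁺ Vec.∷-injectiveʳ (subsetsOfSize-unique n zero)
subsetsOfSize-unique (suc n) (suc k) = Unique.++⁺
  (Unique.map⁺ Vec.∷-injectiveʳ (subsetsOfSize-unique n k))
  (Unique.map⁺ Vec.∷-injectiveʳ (subsetsOfSize-unique n (suc k)))
  λ { (p∈ , p∈′) → disjoint (∈-map⁻ (inside ∷_) p∈) (∈-map⁻ (outside ∷_) p∈′) }
  where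
  disjoint : ∀ {p} → (∃ λ q → q ∈ˡ subsetsOfSize n k × p ≡ inside ∷ q) →
    ¬ (∃ λ q → q ∈ˡ subsetsOfSize n (suc k) × p ≡ outside ∷ q)
  disjoint (_ , _ , refl) (_ , _ , ())

-- Pruning the sets with few extensions.

module _ {n : ℕ} where

  Extends : List (Subset n) → Subset n → Fin n → Set
  Extends F D v = v ∉ D × D ∪ ⁅ v ⁆ ∈ˡ F

  Extends? : ∀ F D → Decidable (Extends F D)
  Extends? F D v = ¬? (v ∈? D) ×-dec ((D ∪ ⁅ v ⁆) ∈ˡˢ? F)

  extensions : List (Subset n) → Subset n → List (Fin n)
  extensions F D = filter (Extends? F D) (allFin n)

  extensions-unique : ∀ F D → Unique (extensions F D)
  extensions-unique F D = Unique.filter⁺ (Extends? F D) (Unique.allFin⁺ n)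

  ∈-extensions⁻ : ∀ F D {v} → v ∈ˡ extensions F D → Extends F D v
  ∈-extensions⁻ F D v∈ = proj₂ (∈-filter⁻ (Extends? F D) {xs = allFin n} v∈)

  -- `∈-shadow` and `full` together make `shadow` exactly the shadow of `family`: a member has an
  -- extension and so arises from an edge.
  record Pruned (s : ℕ) (F Sh : List (Subset n)) : Set where
    field
      family        : List (Subset n)
      family⊆       : family ⊆ˡ F
      family-unique : Unique family
      shadow        : List (Subset n)
      shadow⊆       : shadow ⊆ˡ Sh
      shadow-unique : Unique shadow
      ∈-shadow      : ∀ {e x} → e ∈ˡ family → x ∈ e → e - x ∈ˡ shadow
      full          : ∀ {D} → D ∈ˡ shadow → s < length (extensions family D)
      length-≤      : length F ≤ length family + s * length Sh

  Contains : Subset n → Subset n → Set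
  Contains D e = ∃ λ x → x ∈ e × e - x ≡ D

  Contains? : ∀ D → Decidable (Contains D)
  Contains? D e = Fin.any? λ x → (x ∈? e) ×-dec ((e - x) ≟ˢ D)

  length-Contains : ∀ F D → Unique F → length (filter (Contains? D) F) ≤ length (extensions F D)
  length-Contains F D u = ≤-trans
    (unique-⊆-length (Unique.filter⁺ (Contains? D) u) into)
    (≤-reflexive (length-map _ (extensions F D)))
    where
    into : filter (Contains? D) F ⊆ˡ map (λ v → D ∪ ⁅ v ⁆) (extensions F D)
    into {e} e∈ with e∈F , x , x∈e , refl ← ∈-filter⁻ (Contains? D) {xs = F} e∈ =
      subst (_∈ˡ map (λ v → D ∪ ⁅ v ⁆) (extensions F D)) (p-x∪x x∈e)
        (∈-map⁺ _ (∈-filter⁺ (Extends? F D) (∈-allFin x)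
          (x∉p-x e x , subst (_∈ˡ F) (sym (p-x∪x x∈e)) e∈F)))

  -- Discarding the edges over a poor `D` costs at most `s` edges and removes `D` from `Sh` for
  -- good, so each member of `Sh` is charged at most once.
  prune : ∀ s N F Sh → length Sh ≤ N → Unique F → Unique Sh →
    (∀ {e x} → e ∈ˡ F → x ∈ e → e - x ∈ˡ Sh) → Pruned s F Sh
  prune s N F Sh Sh≤N uF uSh sh with any? (λ D → length (extensions F D) ≤? s) Sh
  ... | no ¬any = record
    { family = F ; family⊆ = id ; family-unique = uF ; shadow = Sh ; shadow⊆ = id ; shadow-unique = uSh
    ; ∈-shadow = sh ; full = λ D∈ → ≰⇒> (λ le → ¬any (lose D∈ le)) ; length-≤ = m≤m+n _ _ }
  ... | yes any with D , D∈ , poor ← find any = go N Sh≤N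
    where
    rest : List (Subset n)
    rest = filter (∁? (Contains? D)) F
    Sh′ : List (Subset n)
    Sh′ = filter (∁? (_≟ˢ D)) Sh
    Sh′< : suc (length Sh′) ≤ length Sh
    Sh′< = subst (suc (length Sh′) ≤_) (sym (length-filter-∁ (_≟ˢ D) Sh))
      (+-monoˡ-≤ (length Sh′) (∈-length (∈-filter⁺ (_≟ˢ D) D∈ refl)))
    sh′ : ∀ {e x} → e ∈ˡ rest → x ∈ e → e - x ∈ˡ Sh′
    sh′ e∈ x∈e with e∈F , ¬c ← ∈-filter⁻ (∁? (Contains? D)) {xs = F} e∈ =
      ∈-filter⁺ (∁? (_≟ˢ D)) (sh e∈F x∈e) (λ eq → ¬c (_ , x∈e , eq))
    go : ∀ N → length Sh ≤ N → Pruned s F Sh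
    go zero    Sh≤0 = contradiction (≤-trans Sh′< Sh≤0) λ ()
    go (suc N) Sh≤N = record
      { family = family ; family⊆ = proj₁ ∘ ∈-filter⁻ (∁? (Contains? D)) ∘ family⊆ ; family-unique = family-unique
      ; shadow = shadow ; shadow⊆ = proj₁ ∘ ∈-filter⁻ (∁? (_≟ˢ D)) ∘ shadow⊆ ; shadow-unique = shadow-unique
      ; ∈-shadow = ∈-shadow ; full = full ; length-≤ = length-≤′ }
      where
      open Pruned (prune s N rest Sh′ (s≤s⁻¹ (≤-trans Sh′< Sh≤N)) (Unique.filter⁺ (∁? (Contains? D)) uF)
        (Unique.filter⁺ (∁? (_≟ˢ D)) uSh) sh′)
      length-≤′ : length F ≤ length family + s * length Sh
      length-≤′ = begin
        length F                                          ≡⟨ length-filter-∁ (Contains? D) F ⟩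
        length (filter (Contains? D) F) + length rest     ≤⟨ +-mono-≤ (≤-trans (length-Contains F D uF) poor) length-≤ ⟩
        s + (length family + s * length Sh′)              ≡⟨ +-assoc s (length family) _ ⟨
        s + length family + s * length Sh′                ≡⟨ cong (_+ s * length Sh′) (+-comm s (length family)) ⟩
        length family + s + s * length Sh′                ≡⟨ +-assoc (length family) s _ ⟩
        length family + (s + s * length Sh′)              ≡⟨ cong (length family +_) (*-suc s (length Sh′)) ⟨
        length family + s * suc (length Sh′)              ≤⟨ +-monoʳ-≤ (length family) (*-monoʳ-≤ s Sh′<) ⟩
        length family + s * length Sh                     ∎
        where open ≤-Reasoning

  ∃-∉ : ∀ {xs W : List (Fin n)} → Unique xs → length W < length xs → ∃ λ x → x ∈ˡ xs × x ∉ˡ W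
  ∃-∉ {xs} {W} u W<xs with any? (λ x → ¬? (x ∈ˡ? W)) xs
  ... | yes any = find any
  ... | no ¬any = contradiction (unique-⊆-length u xs⊆W) (<⇒≱ W<xs)
    where
    xs⊆W : xs ⊆ˡ W
    xs⊆W {x} x∈ with x ∈ˡ? W
    ... | yes x∈W = x∈W
    ... | no  x∉W = contradiction (lose x∈ x∉W) ¬any

  -- Every vertex of an edge can be exchanged for one outside any `ℓ * (2 + k)` forbidden vertices,
  -- so a path grows greedily. An edge has at least two vertices, hence one besides the entry to
  -- serve as the next exit.
  full-path : ∀ {k ℓ F₀ Sh} (F : KFamily n (2 + k)) → F₀ ⊆ˡ sets F → (P : Pruned (ℓ * (2 + k)) F₀ Sh) →
    0 < length (Pruned.family P) → ContainsPath ℓ F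
  full-path {k} {ℓ} {F₀} F F₀⊆ P ne = W.linearPath ℓ ≤-refl (start family id ne)
    where
    open Pruned P
    State : Set
    State = ∃ λ e → ∃ λ v → e ∈ˡ family × v ∈ e
    family⊆F : ∀ {e} → e ∈ˡ family → e ∈F F
    family⊆F e∈ = F₀⊆ (family⊆ e∈)
    size-edge : ∀ {e} → e ∈ˡ family → ∣ e ∣ ≡ 2 + k
    size-edge e∈ = All.lookup (uniform F) (family⊆F e∈)
    element : ∀ {p m} → ∣ p ∣ ≡ suc m → ∃ λ x → x ∈ p
    element {p} eq with elements p in eq′ | trans (length-elements p) eq
    ... | x ∷ _ | _ = x , ∈-elements⁻ (subst (x ∈ˡ_) (sym eq′) (here refl))
    start : ∀ xs → xs ⊆ˡ family → 0 < length xs → State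
    start (e ∷ _) sub _ = let v , v∈ = element (size-edge (sub (here refl))) in e , v , sub (here refl) , v∈
    -- Unwanted vertices other than `v` are exchanged one by one. The replacement avoids all of `W`,
    -- not only `xs`, so it does not bring back a vertex removed before.
    avoid : ∀ W → length W ≤ ℓ * (2 + k) → ∀ xs → xs ⊆ˡ W → ∀ {e v} → e ∈ˡ family → v ∈ e →
      ∃ λ e′ → e′ ∈ˡ family × v ∈ e′ × (∀ {x} → x ∈ˡ xs → x ∈ e′ → x ≡ v)
    avoid W W≤ [] _ {e} e∈ v∈ = e , e∈ , v∈ , λ ()
    avoid W W≤ (x ∷ xs) sub {v = v} e∈ v∈ with avoid W W≤ xs (sub ∘ there) e∈ v∈
    ... | e , e∈ , v∈e , out with x ∈? e | x Fin.≟ v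
    ...   | no  x∉e | _        = e , e∈ , v∈e ,
      λ { (here refl) x∈ → contradiction x∈ x∉e ; (there y∈) y∈e → out y∈ y∈e }
    ...   | yes _   | yes refl = e , e∈ , v∈e , λ { (here refl) _ → refl ; (there y∈) y∈e → out y∈ y∈e }
    ...   | yes x∈e | no x≢v
      with y , y∈ext , y∉W ← ∃-∉ (extensions-unique family (e - x)) (≤-<-trans W≤ (full (∈-shadow e∈ x∈e))) =
      (e - x) ∪ ⁅ y ⁆ , proj₂ (∈-extensions⁻ family (e - x) y∈ext) ,
      x∈p∪q⁺ (inj₁ (x∈p∧x≢y⇒x∈p-y v∈e (x≢v ∘ sym))) , out′
      where
      out′ : ∀ {z} → z ∈ˡ x ∷ xs → z ∈ (e - x) ∪ ⁅ y ⁆ → z ≡ v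
      out′ {z} z∈ z∈e′ with x∈p∪q⁻ (e - x) ⁅ y ⁆ z∈e′
      ... | inj₂ z∈y = contradiction (sub z∈) (subst (_∉ˡ W) (sym (x∈⁅y⁆⇒x≡y y z∈y)) y∉W)
      out′ (here refl) _ | inj₁ z∈e = contradiction z∈e (x∉p-x e x)
      out′ (there z∈)  _ | inj₁ z∈e = out z∈ (p─q⊆p e ⁅ x ⁆ z∈e)
    step : ∀ ((_ , v , _) : State) W → length W ≤ ℓ * (2 + k) →
      ∃ λ ((e′ , v′ , _) : State) → v ∈ e′ × (∀ {x} → x ∈ e′ → x ∈ˡ W → x ≡ v) × v′ ∉ˡ W
    step (_ , v , e∈ , v∈) W W≤
      with e′ , e′∈ , v∈e′ , out ← avoid W W≤ W id e∈ v∈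
      with v′ , v′∈ ← element (suc-injective (trans (∣p-x∣ v∈e′) (size-edge e′∈))) =
      (e′ , v′ , e′∈ , p─q⊆p e′ ⁅ v ⁆ v′∈) , v∈e′ , (λ x∈ x∈W → out x∈W x∈) ,
      λ v′∈W → x∉p-x e′ v (subst (_∈ e′ - v) (out v′∈W (p─q⊆p e′ ⁅ v ⁆ v′∈)) v′∈)
    module W = Walk F (ℓ * (2 + k)) proj₁ (proj₁ ∘ proj₂) (λ (_ , _ , e∈ , _) → family⊆F e∈) (λ (_ , _ , _ , v∈) → v∈) step

-- From a large shadow to a path or a blowup.

-- Out of range, nth returns the default x₀.
nth : ∀ {A : Set} → A → List A → ℕ → A
nth x₀ []       _       = x₀
nth x₀ (x ∷ _)  zero    = x
nth x₀ (_ ∷ xs) (suc i) = nth x₀ xs i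

nth-∈ : ∀ {A : Set} {x₀ : A} xs {i} → i < length xs → nth x₀ xs i ∈ˡ xs
nth-∈ (x ∷ xs) {zero}  _         = here refl
nth-∈ (x ∷ xs) {suc i} (s≤s i<) = there (nth-∈ xs i<)

nth-index : ∀ {A : Set} {x₀ x : A} {xs} → x ∈ˡ xs → ∃ λ i → i < length xs × x ≡ nth x₀ xs i
nth-index (here refl) = 0 , s≤s z≤n , refl
nth-index (there x∈) with i , i< , eq ← nth-index x∈ = suc i , s≤s i< , eq

nth-injective : ∀ {A : Set} {x₀ : A} {xs i j} → Unique xs → i < length xs → j < length xs →
  nth x₀ xs i ≡ nth x₀ xs j → i ≡ j
nth-injective {i = zero}  {zero}  _ _ _ _ = refl
nth-injective {xs = _ ∷ xs} {zero}  {suc j} (x∉ ∷ _) _ (s≤s j<) eq = contradiction eq (All.lookup x∉ (nth-∈ xs j<))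
nth-injective {xs = _ ∷ xs} {suc i} {zero}  (x∉ ∷ _) (s≤s i<) _ eq = contradiction (sym eq) (All.lookup x∉ (nth-∈ xs i<))
nth-injective {xs = _ ∷ _}  {suc i} {suc j} (_ ∷ u) (s≤s i<) (s≤s j<) eq = cong suc (nth-injective u i< j< eq)

-- The size `w` of forbidden lists: the first summand serves the path, the second the blowup, and
-- `suc` makes the sum nonzero as `Extensions` demands.
blowupConstant : (d ℓ t q : ℕ) → ℕ
blowupConstant d ℓ t q = suc (ℓ * (4 + d) + (suc t + q + suc t * q * (2 + d)))

-- The size that `mobile-core` requires, with the power of the number of vertices split off.
shadowConstant : (d ℓ t q : ℕ) → ℕ
shadowConstant d ℓ t q = coef (moveCount d t) * (w + w) ^ (2 + t)
  where w = blowupConstant d ℓ t q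

large-shadow : ∀ {n d ℓ t q Sh} (F : KFamily (suc n) (4 + d)) {F₀} → F₀ ⊆ˡ sets F → (P : Pruned t F₀ Sh) →
  (∀ {D} → D ∈ˡ Sh → ∣ D ∣ ≡ 3 + d) →
  shadowConstant d ℓ t q * suc n ^ (2 + d) < length (Pruned.shadow P) →
  ContainsPath ℓ F ⊎ ContainsBlowupK t q F
large-shadow {n} {d} {ℓ} {t} {q} F F₀⊆ P Sh-size large =
  decide (mobile-core ds-determine large′ shadow-unique)
  where
  open Pruned P
  w : ℕ
  w = blowupConstant d ℓ t q
  ds : Subset (suc n) → Fin (3 + d) → Fin (suc n)
  -- For `D` in `shadow` the default `zero` is not reached: `D` has `3 + d` elements, and more than
  -- `t` extensions for the indices `i ≤ t` of `zs`.
  ds D j = nth zero (elements D) (toℕ j)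
  zs : Subset (suc n) → ℕ → Fin (suc n)
  zs D = nth zero (extensions family D)
  open Extensions {suc n} {d} {t} w ds zs

  size-D : ∀ {D} → D ∈ˡ shadow → length (elements D) ≡ 3 + d
  size-D {D} D∈ = trans (length-elements D) (Sh-size (shadow⊆ D∈))
  ds∈ : ∀ {D} → D ∈ˡ shadow → ∀ j → ds D j ∈ D
  ds∈ {D} D∈ j = ∈-elements⁻ (nth-∈ (elements D) (subst (toℕ j <_) (sym (size-D D∈)) (Fin.toℕ<n j)))
  ds-onto : ∀ {D v} → D ∈ˡ shadow → v ∈ D → ∃ λ j → v ≡ ds D j
  ds-onto {D} D∈ v∈ with i , i< , eq ← nth-index {x₀ = zero} (∈-elements⁺ v∈) =
    fromℕ< i<′ , trans eq (cong (nth zero (elements D)) (sym (Fin.toℕ-fromℕ< i<′)))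
    where
    i<′ : i < 3 + d
    i<′ = subst (i <_) (size-D D∈) i<
  ds-determine : ∀ {D D′} → D ∈ˡ shadow → D′ ∈ˡ shadow → (∀ j → ds D j ≡ ds D′ j) → D ≡ D′
  ds-determine {D} {D′} D∈ D′∈ same = ⊆-antisym
    (λ v∈ → let j , eq = ds-onto D∈ v∈ in subst (_∈ D′) (sym (trans eq (same j))) (ds∈ D′∈ j))
    (λ v∈ → let j , eq = ds-onto D′∈ v∈ in subst (_∈ D) (sym (trans eq (sym (same j)))) (ds∈ D∈ j))
  zs-extends : ∀ {D i} → D ∈ˡ shadow → i < suc t → Extends family D (zs D i)
  zs-extends {D} D∈ i<t = ∈-extensions⁻ family D (nth-∈ (extensions family D) (≤-trans i<t (full D∈)))

  large′ : coef (moveCount d t) * (suc n ^ (2 + d) * (w + w) ^ (2 + t)) < length shadow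
  large′ = subst (_< length shadow)
    (trans (*-assoc c p m) (cong (c *_) (*-comm p m))) large
    where
    c p m : ℕ
    c = coef (moveCount d t)
    p = (w + w) ^ (2 + t)
    m = suc n ^ (2 + d)

  edge⁻ : ∀ {D i v} → D ∈ˡ shadow → v ∈ D ∪ ⁅ zs D i ⁆ → v ≡ zs D i ⊎ ∃ λ j → v ≡ ds D j
  edge⁻ {D} {i} D∈ v∈ with x∈p∪q⁻ D ⁅ zs D i ⁆ v∈
  ... | inj₁ v∈D = inj₂ (ds-onto D∈ v∈D)
  ... | inj₂ v∈z = inj₁ (x∈⁅y⁆⇒x≡y (zs D i) v∈z)

  module Shadow {R} (R⊆ : R ⊆ˡ shadow) = Embedding {k = 4 + d} F (λ D i → D ∪ ⁅ zs D i ⁆) {R}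
    (λ D∈ i<t → F₀⊆ (family⊆ (proj₂ (zs-extends (R⊆ D∈) i<t))))
    (λ D∈ j → x∈p∪q⁺ (inj₁ (ds∈ (R⊆ D∈) j)))
    (x∈p∪q⁺ (inj₂ (x∈⁅x⁆ _)))
    (λ D∈ v∈ → edge⁻ (R⊆ D∈) v∈)

  decide : (∃ λ R → 0 < length R × R ⊆ˡ shadow ×
      (∀ j → ∃ λ i → i ≤ suc t × (∀ {f} → f ∈ˡ R → Mobile (j , i) R f))) →
    ContainsPath ℓ F ⊎ ContainsBlowupK t q F
  decide (R@(D ∷ _) , ne , R⊆ , choice) with Fin.any? (λ j → proj₁ (choice j) <? suc t)
  ... | yes (j₀ , I<t) = inj₁ (Shadow.loose-path R⊆ (proj₁ ∘ choice) (λ j → proj₂ (proj₂ (choice j))) j₀ I<t ne ℓ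
          (≤-trans (m≤m+n _ _) (n≤1+n _)))
  ... | no ¬loose = inj₂ (Shadow.tight-blowup R⊆
          (λ {D} D∈ i<t i′<t → nth-injective (extensions-unique family D)
            (≤-trans i<t (full (R⊆ D∈))) (≤-trans i′<t (full (R⊆ D∈))))
          (λ {D} {i} {j} D∈ i<t eq → proj₁ (zs-extends (R⊆ D∈) i<t) (subst (_∈ D) (sym eq) (ds∈ (R⊆ D∈) j)))
          tight (here refl) q (≤-trans (m≤n+m _ (ℓ * (4 + d))) (n≤1+n _)))
    where
    -- No chosen index is below `t + 1`, so all of them equal it.
    tight : ∀ j {f} → f ∈ˡ R → Mobile (j , suc t) R f
    tight j {f} f∈ = subst (λ i → Mobile (j , i) R f)
      (≤-antisym (proj₁ (proj₂ (choice j))) (≮⇒≥ λ I<t → ¬loose (j , I<t))) (proj₂ (proj₂ (choice j)) f∈)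

-- From the density hypothesis to a large shadow.

^-distribʳ-* : ∀ m x y → (x * y) ^ m ≡ x ^ m * y ^ m
^-distribʳ-* zero    x y = refl
^-distribʳ-* (suc m) x y = trans (cong (x * y *_) (^-distribʳ-* m x y)) ([m*n]*[o*p]≡[m*o]*[n*p] x y (x ^ m) (y ^ m))

^-cancelʳ-≤ : ∀ {x y} m → x ^ suc m ≤ y ^ suc m → x ≤ y
^-cancelʳ-≤ {x} {y} m le with x ≤? y
... | yes x≤y = x≤y
... | no  x≰y = contradiction le (<⇒≱ (^-monoˡ-< (suc m) (≰⇒> x≰y)))

-- Bounding the power of `suc n` below by the exponent `p * suc m` turns the left side into a
-- perfect power, and roots can be compared.
excess-≥ : ∀ c n m p x → c ^ suc m * suc n ^ (p * suc m + 2) ≤ x ^ suc m → c * suc n ^ p ≤ x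
excess-≥ c n m p x dense = ^-cancelʳ-≤ m (begin
  (c * suc n ^ p) ^ suc m             ≡⟨ ^-distribʳ-* (suc m) c (suc n ^ p) ⟩
  c ^ suc m * (suc n ^ p) ^ suc m     ≡⟨ cong (c ^ suc m *_) (^-*-assoc (suc n) p (suc m)) ⟩
  c ^ suc m * suc n ^ (p * suc m)     ≤⟨ *-monoʳ-≤ (c ^ suc m) (^-monoʳ-≤ (suc n) (m≤m+n (p * suc m) 2)) ⟩
  c ^ suc m * suc n ^ (p * suc m + 2) ≤⟨ dense ⟩
  x ^ suc m                           ∎)
  where open ≤-Reasoning

dense⇒path-or-blowup : ∀ {n} d ℓ t q (F : KFamily (suc n) (4 + d)) →
  DenseEnough t (suc (ℓ * (4 + d) * shadowConstant d ℓ t q)) F → ContainsPath ℓ F ⊎ ContainsBlowupK t q F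
dense⇒path-or-blowup {n} d ℓ t q F (_ , dense) = cases (0 <? length (family P₂))
  where
  open Pruned
  s H m : ℕ
  s = ℓ * (4 + d)
  H = shadowConstant d ℓ t q
  m = suc n ^ (2 + d)
  Sh : List (Subset (suc n))
  Sh = subsetsOfSize (suc n) (3 + d)
  P₁ : Pruned t (sets F) Sh
  P₁ = prune t (length Sh) (sets F) Sh ≤-refl (distinct F) (subsetsOfSize-unique (suc n) (3 + d))
    (λ {e} {x} e∈ x∈e → subst (λ l → e - x ∈ˡ subsetsOfSize (suc n) l)
      (suc-injective (trans (∣p-x∣ x∈e) (All.lookup (uniform F) e∈))) (∈-subsetsOfSize⁺ (e - x)))
  P₂ : Pruned s (family P₁) (shadow P₁)
  P₂ = prune s (length (shadow P₁)) (family P₁) (shadow P₁) ≤-refl (family-unique P₁) (shadow-unique P₁) (∈-shadow P₁)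

  family-large : suc (s * H) * m ≤ length (family P₁)
  -- The first pruning loses at most `t` edges per set of size `3 + d`, which is the amount that the
  -- density hypothesis subtracts.
  family-large = ≤-trans (excess-≥ (suc (s * H)) n (2 + d) (2 + d) _ dense)
    (m≤n+o⇒m∸n≤o (size F) (t * (suc n choose (3 + d)))
      (subst (size F ≤_) (trans (+-comm (length (family P₁)) _)
        (cong (λ l → t * l + length (family P₁)) (length-subsetsOfSize (suc n) (3 + d)))) (length-≤ P₁)))

  cases : Dec (0 < length (family P₂)) → ContainsPath ℓ F ⊎ ContainsBlowupK t q F
  cases (yes ne) = inj₁ (full-path {ℓ = ℓ} F (family⊆ P₁) P₂ ne)
  -- With nothing left by the second pruning, the edges of `P₁` number at most `s` times its shadow.
  -- The `suc` in the constant gives the strict inequality from which `s` is cancelled.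
  cases (no ¬ne) = large-shadow {q = q} F id P₁ ∈-subsetsOfSize⁻ (*-cancelˡ-< s (H * m) (length (shadow P₁)) (begin-strict
    s * (H * m)                                 ≡⟨ *-assoc s H m ⟨
    s * H * m                                   <⟨ *-monoˡ-< m {{m^n≢0 (suc n) (2 + d)}} (n<1+n (s * H)) ⟩
    suc (s * H) * m                             ≤⟨ family-large ⟩
    length (family P₁)                          ≤⟨ length-≤ P₂ ⟩
    length (family P₂) + s * length (shadow P₁) ≤⟨ +-monoˡ-≤ (s * length (shadow P₁)) (≮⇒≥ ¬ne) ⟩
    s * length (shadow P₁)                      ∎))
    where open ≤-Reasoning

theorem6p2 : (k ℓ : ℕ) → 4 ≤ k → 1 ≤ ℓ →
    ∃ λ (N : ℕ) → (t q : ℕ) → 1 ≤ t → 1 ≤ q →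
    ∃ λ (C : ℕ) → (n : ℕ) → N ≤ n →
    (F : KFamily n k) → DenseEnough t C F →
    ContainsPath ℓ F ⊎ ContainsBlowupK t q F
theorem6p2 (suc (suc (suc (suc d)))) ℓ (s≤s (s≤s (s≤s (s≤s z≤n)))) _ =
  -- The threshold 1 makes the vertex set nonempty, so that a default vertex exists.
  1 , λ t q _ _ → suc (ℓ * (4 + d) * shadowConstant d ℓ t q) ,
  λ { (suc n) _ F dense → dense⇒path-or-blowup d ℓ t q F dense }
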